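{- Every spherical disk graph has a vertex whose neighborhood is the union of $6$ cliques.
   Context: Graphs are finite, simple and have at least one vertex. The neighborhood of a vertex $v$ is the set of vertices adjacent to $v$; cliques are sets of pairwise adjacent vertices, and in "union of $6$ cliques" the cliques may overlap or be empty (i.e. the neighborhood induces a subgraph with clique cover number at most $6$). On the unit sphere $\mathbb{S}^2\subset\mathbb{R}^3$ with spherical distance $d_{\mathbb{S}^2}(a,b)$ (the angle between vectors $a$ and $b$), the spherical disk of radius $r\in(0,\pi)$ centered at $v$ is $\{u\in\mathbb{S}^2: d_{\mathbb{S}^2}(u,v)\le r\}$. A spherical disk graph is the intersection graph of a finite collection of spherical disks, with radii not necessarily equal (vertices are the disks, two distinct ones adjacent iff they intersect). -}

module Defs where

open import Algebra.Bundles using (CommutativeRing)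
open import Data.Fin.Base using (Fin)
open import Data.Fin.Subset using (Subset; _∈_)
open import Data.Nat.Base using (ℕ; NonZero)
open import Data.Product.Base using (∃-syntax; Σ-syntax; _×_)
open import Data.Vec.Functional using (Vector)
open import Function.Bundles using (_⇔_)
open import Function.Definitions using (Congruent)
open import Level using (0ℓ)
open import Relation.Binary.Core using (Rel)
open import Relation.Binary.Definitions
  using (Symmetric; Irreflexive; Tri; tri<; tri≈; tri>)
open import Relation.Binary.PropositionalEquality.Core using (_≡_; _≢_)
open import Relation.Binary.Structures using (IsStrictTotalOrder)
open import Relation.Nullary.Negation.Core using (¬_)
open import Relation.Unary using (Pred; Satisfiable)

import Algebra.Properties.Monoid.Sum as Sum
import Relation.Binary.Construct.StrictToNonStrict as StrictToNonStrict

-- The standard library has no real numbers, so ℝ is taken to be an arbitrary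
-- model of its usual (classical, categorical) axioms: a Dedekind-complete
-- ordered field.  Equality is the setoid equality _≈_ of the underlying ring,
-- and the trichotomy in IsStrictTotalOrder makes the order decidable.

record CompleteOrderedField : Set₁ where
  infix 4 _<_

  field
    commutativeRing : CommutativeRing 0ℓ 0ℓ

  open CommutativeRing commutativeRing public

  field
    _<_                : Rel Carrier 0ℓ
    isStrictTotalOrder : IsStrictTotalOrder _≈_ _<_

  open StrictToNonStrict _≈_ _<_ public using (_≤_)

  UpperBound : Pred Carrier 0ℓ → Pred Carrier 0ℓ
  UpperBound S u = ∀ x → S x → x ≤ u

  LeastUpperBound : Pred Carrier 0ℓ → Pred Carrier 0ℓ
  LeastUpperBound S s = UpperBound S s × (∀ u → UpperBound S u → s ≤ u)

  field
    0<1      : 0# < 1#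
    inverse  : ∀ x → ¬ (x ≈ 0#) → ∃[ y ] x * y ≈ 1#
    +-mono-< : ∀ {x y} z → x < y → x + z < y + z
    *-pos    : ∀ {x y} → 0# < x → 0# < y → 0# < x * y
    complete : (S : Pred Carrier 0ℓ) → Satisfiable S →
               Satisfiable (UpperBound S) → Satisfiable (LeastUpperBound S)

  compare : ∀ x y → Tri (x < y) (x ≈ y) (y < x)
  compare = IsStrictTotalOrder.compare isStrictTotalOrder

  ∣_∣ : Carrier → Carrier
  ∣ x ∣ with compare x 0#
  ... | tri< _ _ _ = - x
  ... | tri≈ _ _ _ = x
  ... | tri> _ _ _ = x

  -- f is differentiable at x with derivative m.
  HasDerivative : (Carrier → Carrier) → Carrier → Carrier → Set
  HasDerivative f x m =
    ∀ ε → 0# < ε → ∃[ δ ] (0# < δ) ×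
      (∀ h → ∣ h ∣ < δ → ∣ (f (x + h) - f x) - m * h ∣ ≤ ε * ∣ h ∣)

-- Sine and cosine are pinned down as the unique solution on ℝ of
-- sin′ = cos, cos′ = - sin, sin 0 = 0, cos 0 = 1; and π as the least positive
-- zero of sine.

record Trigonometry (R : CompleteOrderedField) : Set where
  open CompleteOrderedField R

  field
    sin cos  : Carrier → Carrier
    sin-cong : Congruent _≈_ _≈_ sin
    cos-cong : Congruent _≈_ _≈_ cos
    sin-0    : sin 0# ≈ 0#
    cos-0    : cos 0# ≈ 1#
    sin′     : ∀ x → HasDerivative sin x (cos x)
    cos′     : ∀ x → HasDerivative cos x (- sin x)

    π        : Carrier
    0<π      : 0# < π
    sin-π    : sin π ≈ 0#
    π-least  : ∀ x → 0# < x → x < π → ¬ (sin x ≈ 0#)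

record Graph : Set₁ where
  field
    order            : ℕ
    {{nonZeroOrder}} : NonZero order

  Vertex : Set
  Vertex = Fin order

  field
    Adj    : Rel Vertex 0ℓ
    sym    : Symmetric Adj
    irrefl : Irreflexive _≡_ Adj

  Neighborhood : Vertex → Pred Vertex 0ℓ
  Neighborhood v u = Adj v u

  IsClique : Subset order → Set
  IsClique Q = ∀ x y → x ∈ Q → y ∈ Q → x ≢ y → Adj x y

  IsUnionOfCliques : ℕ → Pred Vertex 0ℓ → Set
  IsUnionOfCliques k S = Σ[ Q ∈ Vector (Subset order) k ]
    (∀ i → IsClique (Q i)) × (∀ u → S u ⇔ (∃[ i ] u ∈ Q i))

module Spherical (R : CompleteOrderedField) (T : Trigonometry R) where
  open CompleteOrderedField R
  open Trigonometry T

  ⟨_,_⟩ : Vector Carrier 3 → Vector Carrier 3 → Carrier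
  ⟨ a , b ⟩ = Sum.sum +-monoid (λ i → a i * b i)

  record 𝕊² : Set where
    field
      vec  : Vector Carrier 3
      unit : ⟨ vec , vec ⟩ ≈ 1#

  open 𝕊² public

  -- Distance a b θ: the spherical distance of a and b equals θ, i.e. θ is the
  -- angle between the unit vectors a and b, the unique θ ∈ [0, π] whose
  -- cosine is their inner product.
  Distance : 𝕊² → 𝕊² → Carrier → Set
  Distance a b θ = 0# ≤ θ × θ ≤ π × cos θ ≈ ⟨ vec a , vec b ⟩

  record Disk : Set where
    field
      center   : 𝕊²
      radius   : Carrier
      0<radius : 0# < radius
      radius<π : radius < π

  open Disk public

  infix 4 _∈ᴰ_

  _∈ᴰ_ : 𝕊² → Disk → Set
  u ∈ᴰ D = ∃[ θ ] Distance u (center D) θ × θ ≤ radius D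

  Intersect : Disk → Disk → Set
  Intersect D E = ∃[ u ] u ∈ᴰ D × u ∈ᴰ E

  -- The disks form an indexed family, so the same disk may represent several
  -- vertices.
  IsSphericalDiskGraph : Graph → Set
  IsSphericalDiskGraph G =
    Σ[ D ∈ (Vertex → Disk) ] ∀ u v → u ≢ v → Adj u v ⇔ Intersect (D u) (D v)
    where open Graph G

{-# OPTIONS --safe #-}

-- Two disks meet iff the distance of their centers is at most the sum of their
-- radii.  Let v be a smallest disk and divide the sphere into six closed 60°
-- sectors at the center of v.  A spherical triangle o a b with angle at most
-- 60° at o satisfies |ab| ≤ max (|oa|, |ob|), so for neighbors a and b of v in
-- the same sector |ab| ≤ r(v) + max (r(a), r(b)) ≤ r(a) + r(b).

module Submission where

open import Algebra.Bundles using (CommutativeRing)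
open import Data.Empty using (⊥; ⊥-elim)
open import Data.Fin.Base using (Fin; zero; suc)
open import Data.Fin.Patterns using (0F; 1F; 2F; 3F; 4F; 5F)
open import Data.Fin.Properties using (_≟_)
open import Data.Fin.Subset using (Subset; _∈_)
open import Data.Nat.Base using (ℕ; suc)
open import Data.Product.Base using (∃-syntax; _×_; _,_; proj₁; proj₂)
open import Data.Sum.Base using (_⊎_; inj₁; inj₂; [_,_]′)
open import Data.Vec.Base using (tabulate)
open import Data.Vec.Functional using (Vector; []; _∷_)
open import Data.Vec.Properties using (lookup∘tabulate; []=⇒lookup; lookup⇒[]=)
open import Defs
open import Function.Bundles using (_⇔_; mk⇔; Equivalence)
open import Function.Definitions using (Congruent)
open import Level using (0ℓ)
open import Relation.Binary.Bundles using (StrictTotalOrder)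
open import Relation.Binary.Definitions using (tri<; tri≈; tri>)
import Relation.Binary.Definitions as Binary
open import Relation.Binary.PropositionalEquality as ≡ using (_≢_)
open import Relation.Nullary using (¬_; Dec; does; yes; no; contradiction)
open import Relation.Nullary.Decidable using (_⊎-dec_; _×-dec_; ¬?; dec-true)
open import Relation.Unary using (Pred; Decidable)

-- The cliques have to be given as Boolean vectors, so membership must be decided, whereas
-- `Intersect` asks for a point of the sphere. The criterion by distances is a comparison of reals
-- and hence decidable. It is phrased through cosines: inner products are at hand, while an angle
-- has to be produced by the intermediate value theorem. As cosine is monotone only on [0, π], radii
-- with sum at least π form a separate case throughout. The 60° condition also avoids angles.
-- Sectors are cut out by signs of linear forms in tangent coordinates, and the bound on the angle
-- enters as cos ≥ 0 and 4 cos² ≥ 1, both polynomial inequalities. The sectors are closed and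
-- overlap; a center equal or opposite to that of v has tangent coordinates 0 and lies in all six.
-- Sine and cosine are known only through their differential equations, so the addition formulas and
-- the monotonicity of cosine first have to be derived from completeness.

-- A ring solver with integer coefficients.

module IntegerRingSolver (C : CommutativeRing 0ℓ 0ℓ) where

  open CommutativeRing C
  open import Algebra.Properties.Ring ring using (-‿distribˡ-*; -‿distribʳ-*; -‿involutive; -0#≈0#; -‿+-comm)
  open import Algebra.Properties.Semiring.Mult.TCOptimised semiring
    using (1+×; ×-homo-+; ×1-homo-*) renaming (_×_ to _·_)
  open import Algebra.Solver.Ring.AlmostCommutativeRing
    using (fromCommutativeRing; _-Raw-AlmostCommutative⟶_)
  open import Relation.Binary.Reasoning.Setoid setoid
  open import Data.Nat.Base as ℕ using (ℕ; zero; suc)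
  open import Data.Integer.Base as ℤ using (ℤ; +_; -[1+_]; _⊖_)
  import Data.Integer.Properties as ℤ
  open import Data.Maybe.Base using (Maybe; just; nothing)

  -- This version of the multiple `_·_` computes 2 to `1# + 1#` and 3 to `1# + 1# + 1#` without a
  -- trailing `0#`, so the numerals of the solver agree definitionally with the sums written in the
  -- goals.
  fromℤ : ℤ → Carrier
  fromℤ (+ n)    = n · 1#
  fromℤ -[1+ n ] = - (suc n · 1#)

  fromℤ-⊖ : ∀ m n → fromℤ (m ⊖ n) ≈ m · 1# - n · 1#
  fromℤ-⊖ m zero = sym (trans (+-congˡ -0#≈0#) (+-identityʳ _))
  fromℤ-⊖ zero (suc n) = sym (+-identityˡ _)
  fromℤ-⊖ (suc m) (suc n) = begin
    fromℤ (suc m ⊖ suc n)                    ≡⟨ ≡.cong fromℤ (ℤ.[1+m]⊖[1+n]≡m⊖n m n) ⟩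
    fromℤ (m ⊖ n)                            ≈⟨ fromℤ-⊖ m n ⟩
    m · 1# - n · 1#                          ≈⟨ +-congʳ (+-identityʳ _) ⟨
    (m · 1# + 0#) - n · 1#                   ≈⟨ +-congʳ (+-congˡ (-‿inverseʳ 1#)) ⟨
    (m · 1# + (1# - 1#)) - n · 1#            ≈⟨ +-congʳ (+-assoc _ _ _) ⟨
    ((m · 1# + 1#) - 1#) - n · 1#            ≈⟨ +-assoc _ _ _ ⟩
    (m · 1# + 1#) + (- 1# - n · 1#)          ≈⟨ +-cong (+-comm _ _) (-‿+-comm _ _) ⟩
    (1# + m · 1#) - (1# + n · 1#)            ≈⟨ +-cong (1+× m 1#) (-‿cong (1+× n 1#)) ⟨
    suc m · 1# - suc n · 1#                  ∎

  fromℤ-neg : ∀ i → fromℤ (ℤ.- i) ≈ - fromℤ i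
  fromℤ-neg (+ zero)  = sym -0#≈0#
  fromℤ-neg (+ suc n) = refl
  fromℤ-neg -[1+ n ]  = sym (-‿involutive _)

  fromℤ-+ : ∀ i j → fromℤ (i ℤ.+ j) ≈ fromℤ i + fromℤ j
  fromℤ-+ (+ m) (+ n) = ×-homo-+ 1# m n
  fromℤ-+ (+ m) -[1+ n ] = fromℤ-⊖ m (suc n)
  fromℤ-+ -[1+ m ] (+ n) = trans (fromℤ-⊖ n (suc m)) (+-comm _ _)
  fromℤ-+ -[1+ m ] -[1+ n ] = begin
    fromℤ (-[1+ m ] ℤ.+ -[1+ n ])            ≡⟨ ≡.cong fromℤ (ℤ.neg-distrib-+ (+ suc m) (+ suc n)) ⟨
    fromℤ (ℤ.- (+ suc m ℤ.+ + suc n))        ≈⟨ fromℤ-neg (+ suc m ℤ.+ + suc n) ⟩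
    - fromℤ (+ suc m ℤ.+ + suc n)            ≈⟨ -‿cong (fromℤ-+ (+ suc m) (+ suc n)) ⟩
    - (suc m · 1# + suc n · 1#)              ≈⟨ -‿+-comm _ _ ⟨
    - (suc m · 1#) - suc n · 1#              ∎

  fromℤ-+* : ∀ m j → fromℤ (+ m ℤ.* j) ≈ m · 1# * fromℤ j
  fromℤ-+* m (+ n) = begin
    fromℤ (+ m ℤ.* + n)      ≡⟨ ≡.cong fromℤ (ℤ.pos-* m n) ⟨
    (m ℕ.* n) · 1#           ≈⟨ ×1-homo-* m n ⟩
    (m · 1#) * (n · 1#)      ∎
  fromℤ-+* m -[1+ n ] = begin
    fromℤ (+ m ℤ.* -[1+ n ])      ≡⟨ ≡.cong fromℤ (ℤ.neg-distribʳ-* (+ m) (+ suc n)) ⟨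
    fromℤ (ℤ.- (+ m ℤ.* + suc n)) ≈⟨ fromℤ-neg (+ m ℤ.* + suc n) ⟩
    - fromℤ (+ m ℤ.* + suc n)     ≈⟨ -‿cong (fromℤ-+* m (+ suc n)) ⟩
    - (m · 1# * (suc n · 1#))     ≈⟨ -‿distribʳ-* _ _ ⟩
    m · 1# * - (suc n · 1#)       ∎
  fromℤ-* : ∀ i j → fromℤ (i ℤ.* j) ≈ fromℤ i * fromℤ j
  fromℤ-* (+ m)    j = fromℤ-+* m j
  fromℤ-* -[1+ m ] j = begin
    fromℤ (-[1+ m ] ℤ.* j)        ≡⟨ ≡.cong fromℤ (ℤ.neg-distribˡ-* (+ suc m) j) ⟨
    fromℤ (ℤ.- (+ suc m ℤ.* j))   ≈⟨ fromℤ-neg (+ suc m ℤ.* j) ⟩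
    - fromℤ (+ suc m ℤ.* j)       ≈⟨ -‿cong (fromℤ-+* (suc m) j) ⟩
    - (suc m · 1# * fromℤ j)      ≈⟨ -‿distribˡ-* _ _ ⟩
    - (suc m · 1#) * fromℤ j      ∎

  fromℤ-homomorphism : ℤ.+-*-rawRing -Raw-AlmostCommutative⟶ fromCommutativeRing C
  fromℤ-homomorphism = record
    { ⟦_⟧    = fromℤ
    ; +-homo = fromℤ-+
    ; *-homo = fromℤ-*
    ; -‿homo = fromℤ-neg
    ; 0-homo = refl
    ; 1-homo = refl
    }

  _fromℤ≟_ : ∀ i j → Maybe (fromℤ i ≈ fromℤ j)
  i fromℤ≟ j with i ℤ.≟ j
  ... | yes i≡j = just (reflexive (≡.cong fromℤ i≡j))
  ... | no  _   = nothing

  open import Algebra.Solver.Ring ℤ.+-*-rawRing (fromCommutativeRing C)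
    fromℤ-homomorphism _fromℤ≟_ public

  :0 :1 :2 :3 :4 : ∀ {n} → Polynomial n
  :0 = con (+ 0)
  :1 = con (+ 1)
  :2 = con (+ 2)
  :3 = con (+ 3)
  :4 = con (+ 4)

-- Inequalities and absolute values in an ordered field.

module OrderedField (R : CompleteOrderedField) where

  open CompleteOrderedField R hiding (zero)
  open IntegerRingSolver commutativeRing public
    using (solve; _:=_; _:+_; _:*_; _:-_; :-_; :0; :1; :2; :3; :4)
  import Relation.Binary.Construct.StrictToNonStrict _≈_ _<_ as NonStrict

  strictTotalOrder : StrictTotalOrder 0ℓ 0ℓ 0ℓ
  strictTotalOrder = record { isStrictTotalOrder = isStrictTotalOrder }

  open StrictTotalOrder strictTotalOrder public
    using (strictPartialOrder; <-resp-≈; <-respˡ-≈; <-respʳ-≈)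
    renaming (irrefl to <-irrefl; trans to <-trans)

  open import Relation.Binary.Reasoning.StrictPartialOrder strictPartialOrder

  infix 4 _≤?_

  -- Abstract, since otherwise with-abstraction normalises the solver's proof terms.
  abstract

    ≤-refl : ∀ {x} → x ≤ x
    ≤-refl = inj₂ refl

    ≤-reflexive : ∀ {x y} → x ≈ y → x ≤ y
    ≤-reflexive = inj₂

    <⇒≤ : ∀ {x y} → x < y → x ≤ y
    <⇒≤ = inj₁

    ≤-trans : ∀ {x y z} → x ≤ y → y ≤ z → x ≤ z
    ≤-trans = NonStrict.trans isEquivalence <-resp-≈ <-trans

    <-≤-trans : ∀ {x y z} → x < y → y ≤ z → x < z
    <-≤-trans = NonStrict.<-≤-trans <-trans <-respʳ-≈

    ≤-<-trans : ∀ {x y z} → x ≤ y → y < z → x < z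
    ≤-<-trans = NonStrict.≤-<-trans sym <-trans <-respˡ-≈

    ≤-antisym : ∀ {x y} → x ≤ y → y ≤ x → x ≈ y
    ≤-antisym = NonStrict.antisym isEquivalence <-trans <-irrefl

    ≤-total : ∀ x y → x ≤ y ⊎ y ≤ x
    ≤-total = NonStrict.total compare

    _≤?_ : Binary.Decidable _≤_
    _≤?_ = NonStrict.decidable′ compare

    <⇒≱ : ∀ {x y} → x < y → ¬ y ≤ x
    <⇒≱ x<y y≤x = <-irrefl refl (<-≤-trans x<y y≤x)

    ≤-<-connex : ∀ x y → x ≤ y ⊎ y < x
    ≤-<-connex x y with compare x y
    ... | tri< x<y _ _ = inj₁ (inj₁ x<y)
    ... | tri≈ _ x≈y _ = inj₁ (inj₂ x≈y)
    ... | tri> _ _ y<x = inj₂ y<x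

    ≮⇒≥ : ∀ {x y} → ¬ x < y → y ≤ x
    ≮⇒≥ {x} {y} x≮y = [ (λ y≤x → y≤x) , (λ x<y → contradiction x<y x≮y) ]′ (≤-<-connex y x)

    -- Linear arithmetic: a ≤ b is certified by a known inequality p ≤ q together
    -- with a ring identity equating the differences.
    <-by : ∀ {a b p q} → p < q → a + q ≈ b + p → a < b
    <-by {a} {b} {p} {q} p<q eq = begin-strict
      a                ≈⟨ solve 3 (λ a p q → a := p :+ (a :- p)) refl a p q ⟩
      p + (a - p)      <⟨ +-mono-< (a - p) p<q ⟩
      q + (a - p)      ≈⟨ solve 3 (λ a p q → q :+ (a :- p) := (a :+ q) :- p) refl a p q ⟩
      (a + q) - p      ≈⟨ +-congʳ eq ⟩
      (b + p) - p      ≈⟨ solve 2 (λ b p → (b :+ p) :- p := b) refl b p ⟩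
      b                ∎

    ≤-by : ∀ {a b p q} → p ≤ q → a + q ≈ b + p → a ≤ b
    ≤-by (inj₁ p<q) eq = inj₁ (<-by p<q eq)
    ≤-by {a} {b} {p} {q} (inj₂ p≈q) eq = inj₂ (begin-equality
      a                ≈⟨ solve 2 (λ a q → a := (a :+ q) :- q) refl a q ⟩
      (a + q) - q      ≈⟨ +-congʳ (trans eq (+-congˡ p≈q)) ⟩
      (b + q) - q      ≈⟨ solve 2 (λ b p → (b :+ p) :- p := b) refl b q ⟩
      b                ∎)

    +-mono-≤ : ∀ {a b c d} → a ≤ b → c ≤ d → a + c ≤ b + d
    +-mono-≤ {a} {b} {c} {d} a≤b c≤d = ≤-trans
      (≤-by a≤b (solve 3 (λ a b c → (a :+ c) :+ b := (b :+ c) :+ a) refl a b c))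
      (≤-by c≤d (solve 3 (λ b c d → (b :+ c) :+ d := (b :+ d) :+ c) refl b c d))

    +-mono-<-≤ : ∀ {a b c d} → a < b → c ≤ d → a + c < b + d
    +-mono-<-≤ {a} {b} {c} {d} a<b c≤d = <-≤-trans (+-mono-< c a<b) (+-mono-≤ ≤-refl c≤d)

    +-pos : ∀ {a b} → 0# < a → 0# < b → 0# < a + b
    +-pos 0<a 0<b = <-respˡ-≈ (+-identityʳ 0#) (+-mono-<-≤ 0<a (<⇒≤ 0<b))

    +-nonneg : ∀ {a b} → 0# ≤ a → 0# ≤ b → 0# ≤ a + b
    +-nonneg 0≤a 0≤b = ≤-trans (≤-reflexive (sym (+-identityʳ 0#))) (+-mono-≤ 0≤a 0≤b)

    x≤y⇒0≤y-x : ∀ {x y} → x ≤ y → 0# ≤ y - x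
    x≤y⇒0≤y-x {x} {y} x≤y = ≤-by x≤y (solve 2 (λ x y → :0 :+ y := (y :- x) :+ x) refl x y)

    0≤y-x⇒x≤y : ∀ {x y} → 0# ≤ y - x → x ≤ y
    0≤y-x⇒x≤y {x} {y} h = ≤-by h (solve 2 (λ x y → x :+ (y :- x) := y :+ :0) refl x y)

    x<y⇒0<y-x : ∀ {x y} → x < y → 0# < y - x
    x<y⇒0<y-x {x} {y} x<y = <-by x<y (solve 2 (λ x y → :0 :+ y := (y :- x) :+ x) refl x y)

    0<y-x⇒x<y : ∀ {x y} → 0# < y - x → x < y
    0<y-x⇒x<y {x} {y} h = <-by h (solve 2 (λ x y → x :+ (y :- x) := y :+ :0) refl x y)

    neg-mono-≤ : ∀ {x y} → x ≤ y → - y ≤ - x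
    neg-mono-≤ {x} {y} x≤y = ≤-by x≤y (solve 2 (λ x y → :- y :+ y := :- x :+ x) refl x y)

    x≤0⇒0≤-x : ∀ {x} → x ≤ 0# → 0# ≤ - x
    x≤0⇒0≤-x {x} x≤0 = ≤-by x≤0 (solve 1 (λ x → :0 :+ :0 := :- x :+ x) refl x)

    0≤x⇒-x≤0 : ∀ {x} → 0# ≤ x → - x ≤ 0#
    0≤x⇒-x≤0 {x} 0≤x = ≤-by 0≤x (solve 1 (λ x → :- x :+ x := :0 :+ :0) refl x)

    *-nonneg : ∀ {a b} → 0# ≤ a → 0# ≤ b → 0# ≤ a * b
    *-nonneg (inj₁ 0<a) (inj₁ 0<b) = inj₁ (*-pos 0<a 0<b)
    *-nonneg {a} {b} (inj₂ 0≈a) _ = inj₂ (sym (trans (*-congʳ (sym 0≈a)) (zeroˡ b)))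
    *-nonneg {a} {b} _ (inj₂ 0≈b) = inj₂ (sym (trans (*-congˡ (sym 0≈b)) (zeroʳ a)))

    square-nonneg : ∀ x → 0# ≤ x * x
    square-nonneg x with ≤-total 0# x
    ... | inj₁ 0≤x = *-nonneg 0≤x 0≤x
    ... | inj₂ x≤0 = ≤-trans (*-nonneg (x≤0⇒0≤-x x≤0) (x≤0⇒0≤-x x≤0))
                       (≤-reflexive (solve 1 (λ x → :- x :* :- x := x :* x) refl x))

    *-monoʳ-≤ : ∀ {a b c} → 0# ≤ c → a ≤ b → a * c ≤ b * c
    *-monoʳ-≤ {a} {b} {c} 0≤c a≤b = ≤-by (*-nonneg (x≤y⇒0≤y-x a≤b) 0≤c)
      (solve 3 (λ a b c → a :* c :+ (b :- a) :* c := b :* c :+ :0) refl a b c)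

    *-monoʳ-< : ∀ {a b c} → 0# < c → a < b → a * c < b * c
    *-monoʳ-< {a} {b} {c} 0<c a<b = <-by (*-pos (x<y⇒0<y-x a<b) 0<c)
      (solve 3 (λ a b c → a :* c :+ (b :- a) :* c := b :* c :+ :0) refl a b c)

    *-monoˡ-≤ : ∀ {a b c} → 0# ≤ c → a ≤ b → c * a ≤ c * b
    *-monoˡ-≤ {a} {b} {c} 0≤c a≤b = begin
      c * a  ≈⟨ *-comm c a ⟩
      a * c  ≤⟨ *-monoʳ-≤ 0≤c a≤b ⟩
      b * c  ≈⟨ *-comm b c ⟩
      c * b  ∎

    *-mono-≤ : ∀ {a b c d} → 0# ≤ a → 0# ≤ d → a ≤ b → c ≤ d → a * c ≤ b * d
    *-mono-≤ 0≤a 0≤d a≤b c≤d = ≤-trans (*-monoˡ-≤ 0≤a c≤d) (*-monoʳ-≤ 0≤d a≤b)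

    *-cancelʳ-≤ : ∀ {a b c} → 0# < c → a * c ≤ b * c → a ≤ b
    *-cancelʳ-≤ 0<c ac≤bc = ≮⇒≥ λ b<a → <⇒≱ (*-monoʳ-< 0<c b<a) ac≤bc

    -- If y < x then (x - y)(x + y) > 0. Later estimates use this in place of square roots.
    square-cancel-≤ : ∀ {x y} → 0# ≤ y → x * x ≤ y * y → x ≤ y
    square-cancel-≤ {x} {y} 0≤y xx≤yy = ≮⇒≥ λ y<x → <⇒≱ (0<y-x⇒x<y (<-≤-trans
      (*-pos (x<y⇒0<y-x y<x) (<-by (+-mono-<-≤ (≤-<-trans 0≤y y<x) 0≤y)
        (solve 2 (λ x y → :0 :+ (x :+ y) := (x :+ y) :+ (:0 :+ :0)) refl x y)))
      (≤-reflexive (solve 2 (λ x y → (x :- y) :* (x :+ y) := x :* x :- y :* y) refl x y)))) xx≤yy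

    *-cancelˡ-≈0 : ∀ {x y} → ¬ x ≈ 0# → x * y ≈ 0# → y ≈ 0#
    *-cancelˡ-≈0 {x} {y} x≉0 xy≈0 with z , xz≈1 ← inverse x x≉0 = begin-equality
      y            ≈⟨ *-identityˡ y ⟨
      1# * y       ≈⟨ *-congʳ xz≈1 ⟨
      x * z * y    ≈⟨ solve 3 (λ x y z → x :* z :* y := z :* (x :* y)) refl x y z ⟩
      z * (x * y)  ≈⟨ trans (*-congˡ xy≈0) (zeroʳ z) ⟩
      0#           ∎

    *-zero-split : ∀ {x y} → x * y ≈ 0# → x ≈ 0# ⊎ y ≈ 0#
    *-zero-split {x} {y} xy≈0 with compare x 0#
    ... | tri< _ x≉0 _ = inj₂ (*-cancelˡ-≈0 x≉0 xy≈0)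
    ... | tri≈ _ x≈0 _ = inj₁ x≈0
    ... | tri> _ x≉0 _ = inj₂ (*-cancelˡ-≈0 x≉0 xy≈0)

    square≈0⇒≈0 : ∀ {x} → x * x ≈ 0# → x ≈ 0#
    square≈0⇒≈0 xx≈0 = [ (λ x≈0 → x≈0) , (λ x≈0 → x≈0) ]′ (*-zero-split xx≈0)

    >0⇒≉0 : ∀ {x} → 0# < x → ¬ x ≈ 0#
    >0⇒≉0 0<x x≈0 = <-irrefl (sym x≈0) 0<x

    positive-inverse : ∀ {x} → 0# < x → ∃[ y ] 0# < y × x * y ≈ 1#
    positive-inverse {x} 0<x with y , xy≈1 ← inverse x (>0⇒≉0 0<x) =
      y , [ (λ y≤0 → ⊥-elim (<⇒≱ 0<1 (≤-by (*-nonneg (<⇒≤ 0<x) (x≤0⇒0≤-x y≤0))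
              (begin-equality
                1# + x * - y     ≈⟨ +-congʳ xy≈1 ⟨
                x * y + x * - y  ≈⟨ solve 2 (λ x y → x :* y :+ x :* :- y := :0 :+ :0) refl x y ⟩
                0# + 0#          ∎))))
          , (λ 0<y → 0<y) ]′ (≤-<-connex y 0#) , xy≈1

    0≤1 : 0# ≤ 1#
    0≤1 = <⇒≤ 0<1

    0<2 : 0# < 1# + 1#
    0<2 = +-pos 0<1 0<1

    ½ : Carrier
    ½ = proj₁ (positive-inverse 0<2)

    0<½ : 0# < ½
    0<½ = proj₁ (proj₂ (positive-inverse 0<2))

    2*½≈1 : (1# + 1#) * ½ ≈ 1#
    2*½≈1 = proj₂ (proj₂ (positive-inverse 0<2))

    x*½+x*½≈x : ∀ x → x * ½ + x * ½ ≈ x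
    x*½+x*½≈x x = begin-equality
      x * ½ + x * ½      ≈⟨ solve 2 (λ x h → x :* h :+ x :* h := x :* (:2 :* h)) refl x ½ ⟩
      x * ((1# + 1#) * ½) ≈⟨ *-congˡ 2*½≈1 ⟩
      x * 1#             ≈⟨ *-identityʳ x ⟩
      x                  ∎

    half-pos : ∀ {x} → 0# < x → 0# < x * ½
    half-pos 0<x = *-pos 0<x 0<½

    half-< : ∀ {x} → 0# < x → x * ½ < x
    half-< {x} 0<x = <-by (half-pos 0<x) (trans (x*½+x*½≈x x) (sym (+-identityʳ x)))

    ∣∣-cases : ∀ x → (0# ≤ x × ∣ x ∣ ≈ x) ⊎ (x < 0# × ∣ x ∣ ≈ - x)
    ∣∣-cases x with compare x 0#
    ... | tri< x<0 _ _ = inj₂ (x<0 , refl)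
    ... | tri≈ _ x≈0 _ = inj₁ (inj₂ (sym x≈0) , refl)
    ... | tri> _ _ 0<x = inj₁ (inj₁ 0<x , refl)

    x≤∣x∣ : ∀ x → x ≤ ∣ x ∣
    x≤∣x∣ x with ∣∣-cases x
    ... | inj₁ (_ , eq)   = ≤-reflexive (sym eq)
    ... | inj₂ (x<0 , eq) = ≤-trans (<⇒≤ x<0) (≤-trans (x≤0⇒0≤-x (<⇒≤ x<0)) (≤-reflexive (sym eq)))

    -x≤∣x∣ : ∀ x → - x ≤ ∣ x ∣
    -x≤∣x∣ x with ∣∣-cases x
    ... | inj₁ (0≤x , eq) = ≤-trans (0≤x⇒-x≤0 0≤x) (≤-trans 0≤x (≤-reflexive (sym eq)))
    ... | inj₂ (_ , eq)   = ≤-reflexive (sym eq)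

    ∣∣-≤ : ∀ {x b} → x ≤ b → - x ≤ b → ∣ x ∣ ≤ b
    ∣∣-≤ {x} x≤b -x≤b with ∣∣-cases x
    ... | inj₁ (_ , eq) = ≤-trans (≤-reflexive eq) x≤b
    ... | inj₂ (_ , eq) = ≤-trans (≤-reflexive eq) -x≤b

    ∣∣-< : ∀ {x b} → x < b → - x < b → ∣ x ∣ < b
    ∣∣-< {x} x<b -x<b with ∣∣-cases x
    ... | inj₁ (_ , eq) = <-respˡ-≈ (sym eq) x<b
    ... | inj₂ (_ , eq) = <-respˡ-≈ (sym eq) -x<b

    ∣∣-nonneg : ∀ x → 0# ≤ ∣ x ∣
    ∣∣-nonneg x with ∣∣-cases x
    ... | inj₁ (0≤x , eq) = ≤-trans 0≤x (≤-reflexive (sym eq))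
    ... | inj₂ (x<0 , eq) = ≤-trans (x≤0⇒0≤-x (<⇒≤ x<0)) (≤-reflexive (sym eq))

    ∣∣-cong-≤ : ∀ {x y} → x ≈ y → ∣ x ∣ ≤ ∣ y ∣
    ∣∣-cong-≤ {x} {y} x≈y = ∣∣-≤ (≤-trans (≤-reflexive x≈y) (x≤∣x∣ y))
                                 (≤-trans (≤-reflexive (-‿cong x≈y)) (-x≤∣x∣ y))

    0≤x⇒∣x∣≈x : ∀ {x} → 0# ≤ x → ∣ x ∣ ≈ x
    0≤x⇒∣x∣≈x {x} 0≤x = ≤-antisym
      (∣∣-≤ ≤-refl (≤-trans (0≤x⇒-x≤0 0≤x) 0≤x)) (x≤∣x∣ x)

    ∣-x∣≤∣x∣ : ∀ x → ∣ - x ∣ ≤ ∣ x ∣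
    ∣-x∣≤∣x∣ x = ∣∣-≤ (-x≤∣x∣ x) (≤-trans (≤-reflexive (solve 1 (λ x → :- :- x := x) refl x)) (x≤∣x∣ x))

    ∣x+y∣≤∣x∣+∣y∣ : ∀ x y → ∣ x + y ∣ ≤ ∣ x ∣ + ∣ y ∣
    ∣x+y∣≤∣x∣+∣y∣ x y = ∣∣-≤ (+-mono-≤ (x≤∣x∣ x) (x≤∣x∣ y))
      (≤-trans (≤-reflexive (solve 2 (λ x y → :- (x :+ y) := :- x :+ :- y) refl x y))
               (+-mono-≤ (-x≤∣x∣ x) (-x≤∣x∣ y)))

    ∣x*y∣≤∣x∣*∣y∣ : ∀ x y → ∣ x * y ∣ ≤ ∣ x ∣ * ∣ y ∣
    ∣x*y∣≤∣x∣*∣y∣ x y with ∣∣-cases x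
    ... | inj₁ (_ , ∣x∣≈x)  = ∣∣-≤
      (≤-trans (≤-reflexive (*-congʳ (sym ∣x∣≈x))) ∣x∣y≤)
      (≤-trans (≤-reflexive (trans (solve 2 (λ x y → :- (x :* y)
          := x :* :- y) refl x y) (*-congʳ (sym ∣x∣≈x)))) ∣x∣-y≤)
      where
      ∣x∣y≤ : ∣ x ∣ * y ≤ ∣ x ∣ * ∣ y ∣
      ∣x∣y≤ = *-monoˡ-≤ (∣∣-nonneg x) (x≤∣x∣ y)
      ∣x∣-y≤ : ∣ x ∣ * - y ≤ ∣ x ∣ * ∣ y ∣
      ∣x∣-y≤ = *-monoˡ-≤ (∣∣-nonneg x) (-x≤∣x∣ y)
    ... | inj₂ (_ , ∣x∣≈-x) = ∣∣-≤
      (≤-trans (≤-reflexive (trans (solve 2 (λ x y → x :* y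
          := :- x :* :- y) refl x y) (*-congʳ (sym ∣x∣≈-x)))) ∣x∣-y≤)
      (≤-trans (≤-reflexive (trans (solve 2 (λ x y → :- (x :* y)
          := :- x :* y) refl x y) (*-congʳ (sym ∣x∣≈-x)))) ∣x∣y≤)
      where
      ∣x∣y≤ : ∣ x ∣ * y ≤ ∣ x ∣ * ∣ y ∣
      ∣x∣y≤ = *-monoˡ-≤ (∣∣-nonneg x) (x≤∣x∣ y)
      ∣x∣-y≤ : ∣ x ∣ * - y ≤ ∣ x ∣ * ∣ y ∣
      ∣x∣-y≤ = *-monoˡ-≤ (∣∣-nonneg x) (-x≤∣x∣ y)

-- Continuity, intermediate values and rules of differentiation.

module Calculus (R : CompleteOrderedField) where

  open CompleteOrderedField R hiding (zero)
  open OrderedField R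
  open import Relation.Binary.Reasoning.StrictPartialOrder strictPartialOrder

  abstract

    positive-min : ∀ {a b} → 0# < a → 0# < b → ∃[ c ] 0# < c × c ≤ a × c ≤ b
    positive-min {a} {b} 0<a 0<b with ≤-total a b
    ... | inj₁ a≤b = a , 0<a , ≤-refl , a≤b
    ... | inj₂ b≤a = b , 0<b , b≤a , ≤-refl

    arbitrarily-small : ∀ {M η} → 0# < M → 0# < η → ∃[ ε ] 0# < ε × ε ≤ 1# × ε * M ≤ η
    arbitrarily-small {M} {η} 0<M 0<η
      with M⁻¹ , 0<M⁻¹ , MM⁻¹≈1 ← positive-inverse 0<M
      with ε , 0<ε , ε≤1 , ε≤ηM⁻¹ ← positive-min 0<1 (*-pos 0<η 0<M⁻¹)
      = ε , 0<ε , ε≤1 , (begin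
        ε * M          ≤⟨ *-monoʳ-≤ (<⇒≤ 0<M) ε≤ηM⁻¹ ⟩
        η * M⁻¹ * M    ≈⟨ solve 3 (λ η k M → η :* k :* M := η :* (M :* k)) refl η M⁻¹ M ⟩
        η * (M * M⁻¹)  ≈⟨ *-congˡ MM⁻¹≈1 ⟩
        η * 1#         ≈⟨ *-identityʳ η ⟩
        η              ∎)

    0<1+nonneg : ∀ {x} → 0# ≤ x → 0# < x + 1#
    0<1+nonneg {x} 0≤x = <-respʳ-≈ (+-comm 1# x)
      (<-respˡ-≈ (+-identityʳ 0#) (+-mono-<-≤ 0<1 0≤x))

  increment : ∀ f → Congruent _≈_ _≈_ f → ∀ x y → f (x + (y - x)) ≈ f y
  increment f f-cong x y = f-cong (solve 2 (λ x y → x :+ (y :- x) := y) refl x y)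

  Continuous : (Carrier → Carrier) → Carrier → Set
  Continuous f x = ∀ ε → 0# < ε → ∃[ δ ] 0# < δ × (∀ y → ∣ y - x ∣ < δ → ∣ f y - f x ∣ ≤ ε)

  -- Tolerance 1 in the derivative gives the local bound |f y - f x| ≤ (|m| + 1) |y - x|, which is
  -- at most ε as soon as |y - x| is below `δ₂`.
  differentiable⇒continuous : ∀ f {x m} → Congruent _≈_ _≈_ f → HasDerivative f x m → Continuous f x
  differentiable⇒continuous f {x} {m} f-cong f′ ε 0<ε
    with δ₁ , 0<δ₁ , near ← f′ 1# 0<1
    with δ₂ , 0<δ₂ , _ , δ₂M≤ε ← arbitrarily-small (0<1+nonneg (∣∣-nonneg m)) 0<ε
    with δ , 0<δ , δ≤δ₁ , δ≤δ₂ ← positive-min 0<δ₁ 0<δ₂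
    = δ , 0<δ , λ y ∣y-x∣<δ → let h = y - x in begin
      ∣ f y - f x ∣                                    ≤⟨ ∣∣-cong-≤ (+-congʳ (sym (increment f f-cong x y))) ⟩
      ∣ f (x + h) - f x ∣
          ≤⟨ ∣∣-cong-≤ (solve 2 (λ d e → d := e :+ (d :- e)) refl _ (m * h)) ⟩
      ∣ m * h + ((f (x + h) - f x) - m * h) ∣          ≤⟨ ∣x+y∣≤∣x∣+∣y∣ _ _ ⟩
      ∣ m * h ∣ + ∣ (f (x + h) - f x) - m * h ∣
          ≤⟨ +-mono-≤ (∣x*y∣≤∣x∣*∣y∣ m h) (near h (<-≤-trans ∣y-x∣<δ δ≤δ₁)) ⟩
      ∣ m ∣ * ∣ h ∣ + 1# * ∣ h ∣                       ≈⟨ distribʳ _ _ _ ⟨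
      (∣ m ∣ + 1#) * ∣ h ∣
          ≤⟨ *-monoˡ-≤ (<⇒≤ (0<1+nonneg (∣∣-nonneg m))) (≤-trans (<⇒≤ ∣y-x∣<δ) δ≤δ₂) ⟩
      (∣ m ∣ + 1#) * δ₂                                ≈⟨ *-comm _ _ ⟩
      δ₂ * (∣ m ∣ + 1#)                                ≤⟨ δ₂M≤ε ⟩
      ε                                                ∎

  abstract

    -- Otherwise s - δ/2 would already be an upper bound. Since `S` is an arbitrary predicate, no
    -- nearby element is exhibited; the statement is a refutation, to be used inside other
    -- refutations.
    supremum-approached : ∀ {S : Pred Carrier 0ℓ} {s} → LeastUpperBound S s → ∀ {δ} → 0# < δ →
                          (∀ x → S x → ∣ x - s ∣ < δ → ⊥) → ⊥
    supremum-approached {S} {s} (ub , least) {δ} 0<δ none =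
      <⇒≱ u<s (least (s - δ * ½) λ x x∈S → [ (λ x≤u → x≤u) , (λ u<x → ⊥-elim (none x x∈S (close (ub x x∈S) u<x))) ]′
                                             (≤-<-connex x (s - δ * ½)))
      where
      u<s : s - δ * ½ < s
      u<s = <-by (half-pos 0<δ) (solve 2 (λ s d → (s :- d) :+ d := s :+ :0) refl s (δ * ½))
      close : ∀ {x} → x ≤ s → s - δ * ½ < x → ∣ x - s ∣ < δ
      close {x} x≤s u<x = ∣∣-<
        (≤-<-trans (≤-by x≤s (solve 2 (λ x s → (x :- s) :+ s := :0 :+ x) refl x s)) 0<δ)
        (<-trans (<-by u<x (solve 3 (λ x s d → :- (x :- s) :+ x := d :+ (s :- d)) refl x s (δ * ½))) (half-< 0<δ))

    step-right : ∀ {s b δ} → s < b → 0# < δ → ∃[ y ] s < y × y ≤ b × ∣ y - s ∣ < δ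
    step-right {s} {b} {δ} s<b 0<δ
      with h , 0<h , h≤δ½ , h≤b-s ← positive-min (half-pos 0<δ) (x<y⇒0<y-x s<b)
      = s + h
      , <-by 0<h (solve 2 (λ s h → s :+ h := (s :+ h) :+ :0) refl s h)
      , ≤-by h≤b-s (solve 3 (λ s h b → (s :+ h) :+ (b :- s) := b :+ h) refl s h b)
      , (begin-strict
          ∣ (s + h) - s ∣  ≤⟨ ∣∣-cong-≤ (solve 2 (λ s h → (s :+ h) :- s := h) refl s h) ⟩
          ∣ h ∣            ≈⟨ 0≤x⇒∣x∣≈x (<⇒≤ 0<h) ⟩
          h                ≤⟨ h≤δ½ ⟩
          δ * ½            <⟨ half-< 0<δ ⟩
          δ                ∎)

  abstract
    -- The root is the supremum of the points of [a, b] with value at most c. A value above c there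
    -- would persist nearby, away from `S`; a value below c would persist a little to the right,
    -- inside `S`.
    intermediate-value : ∀ f → Congruent _≈_ _≈_ f → (∀ x → Continuous f x) →
                         ∀ {a b c} → a ≤ b → f a ≤ c → c ≤ f b → ∃[ s ] a ≤ s × s ≤ b × f s ≈ c
    intermediate-value f f-cong cts {a} {b} {c} a≤b fa≤c c≤fb =
      root (complete S (a , a∈S) (b , λ x x∈S → proj₁ (proj₂ x∈S)))
      where
      S : Pred Carrier 0ℓ
      S x = a ≤ x × x ≤ b × f x ≤ c

      a∈S : S a
      a∈S = ≤-refl , a≤b , fa≤c

      not-above : ∀ {s} → LeastUpperBound S s → c < f s → ⊥
      -- The tolerance is half the gap: `Continuous` is stated with `≤`, so the full gap would not
      -- be contradictory.
      not-above {s} s-sup c<fs with δ , 0<δ , near ← cts s ((f s - c) * ½) (half-pos (x<y⇒0<y-x c<fs)) =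
        supremum-approached s-sup 0<δ λ { x (_ , _ , fx≤c) ∣x-s∣<δ → <⇒≱ (half-< (x<y⇒0<y-x c<fs)) (begin
          f s - c            ≤⟨ ≤-by fx≤c (solve 3 (λ u v c → (v :- c) :+ c := :- (u :- v) :+ u) refl (f x) (f s) c) ⟩
          - (f x - f s)      ≤⟨ -x≤∣x∣ _ ⟩
          ∣ f x - f s ∣      ≤⟨ near x ∣x-s∣<δ ⟩
          (f s - c) * ½      ∎) }

      not-below : ∀ {s} → LeastUpperBound S s → s < b → f s < c → ⊥
      not-below {s} (ub , _) s<b fs<c
        with δ , 0<δ , near ← cts s ((c - f s) * ½) (half-pos (x<y⇒0<y-x fs<c))
        with y , s<y , y≤b , ∣y-s∣<δ ← step-right s<b 0<δ
        = <⇒≱ s<y (ub y (≤-trans (ub a a∈S) (<⇒≤ s<y) , y≤b , ≤-by (begin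
          f y - f s          ≤⟨ x≤∣x∣ _ ⟩
          ∣ f y - f s ∣      ≤⟨ near y ∣y-s∣<δ ⟩
          (c - f s) * ½      ≤⟨ <⇒≤ (half-< (x<y⇒0<y-x fs<c)) ⟩
          c - f s            ∎) (solve 3 (λ u v c → u :+ (c :- v) := c :+ (u :- v)) refl (f y) (f s) c)))

      root : ∃[ s ] LeastUpperBound S s → ∃[ s ] a ≤ s × s ≤ b × f s ≈ c
      root (s , s-sup@(ub , least)) = s , ub a a∈S , s≤b , ≤-antisym
        (≮⇒≥ (not-above s-sup))
        (≮⇒≥ λ fs<c → [ (λ s<b → not-below s-sup s<b fs<c)
                      , (λ s≈b → <⇒≱ fs<c (≤-trans c≤fb (≤-reflexive (f-cong (sym s≈b))))) ]′ s≤b)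
        where
        s≤b : s ≤ b
        s≤b = least b λ x x∈S → proj₁ (proj₂ x∈S)

  infinitesimal⇒≈0 : ∀ {x b} → 0# ≤ b → (∀ ε → 0# < ε → ∣ x ∣ ≤ ε * b) → x ≈ 0#
  infinitesimal⇒≈0 {x} {b} 0≤b small with ≤-<-connex ∣ x ∣ 0#
  ... | inj₁ ∣x∣≤0 = ≤-antisym (≤-trans (x≤∣x∣ x) ∣x∣≤0)
                       (≤-by (≤-trans (-x≤∣x∣ x) ∣x∣≤0) (solve 1 (λ x → :0 :+ :0 := x :+ :- x) refl x))
  ... | inj₂ 0<∣x∣ with ε , 0<ε , _ , ε[b+1]≤∣x∣ ← arbitrarily-small (0<1+nonneg 0≤b) 0<∣x∣ =
    ⊥-elim (<⇒≱ 0<ε (≤-by (≤-trans ε[b+1]≤∣x∣ (small ε 0<ε))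
      (solve 2 (λ ε b → ε :+ ε :* b := :0 :+ ε :* (b :+ :1)) refl ε b)))

  -- This stands in for the mean value theorem. For fixed ε, take the supremum of the x in [0, b]
  -- with |f x - f 0| ≤ ε x. The flatness of f carries this bound to the supremum, and then slightly
  -- beyond it unless the supremum is b. Finally ε is arbitrary.
  zero-derivative⇒constant : ∀ f → Congruent _≈_ _≈_ f → (∀ x → HasDerivative f x 0#) →
                             ∀ {b} → 0# ≤ b → f b ≈ f 0#
  zero-derivative⇒constant f f-cong f′≈0 {b} 0≤b = begin-equality
    f b                  ≈⟨ solve 2 (λ u v → u := (u :- v) :+ v) refl (f b) (f 0#) ⟩
    (f b - f 0#) + f 0#  ≈⟨ +-congʳ (infinitesimal⇒≈0 0≤b bound) ⟩
    0# + f 0#            ≈⟨ +-identityˡ _ ⟩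
    f 0#                 ∎
    where
    bound : ∀ ε → 0# < ε → ∣ f b - f 0# ∣ ≤ ε * b
    bound ε 0<ε = b-good (proj₂ (complete S (0# , 0∈S) (b , λ x x∈S → proj₁ (proj₂ x∈S))))
      where
      flat : ∀ x → ∃[ δ ] 0# < δ × (∀ y → ∣ y - x ∣ < δ → ∣ f y - f x ∣ ≤ ε * ∣ y - x ∣)
      flat x with δ , 0<δ , near ← f′≈0 x ε 0<ε = δ , 0<δ , λ y ∣y-x∣<δ → begin
        ∣ f y - f x ∣                                     ≤⟨ ∣∣-cong-≤ (+-congʳ (sym (increment f f-cong x y))) ⟩
        ∣ f (x + (y - x)) - f x ∣                         ≤⟨ ∣∣-cong-≤ (solve 2 (λ u h → u
            := u :- :0 :* h) refl _ (y - x)) ⟩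
        ∣ (f (x + (y - x)) - f x) - 0# * (y - x) ∣        ≤⟨ near (y - x) ∣y-x∣<δ ⟩
        ε * ∣ y - x ∣                                     ∎

      chain : ∀ {x y z} → ∣ f y - f x ∣ ≤ ε * (y - x) → ∣ f z - f y ∣ ≤ ε * (z - y) → ∣ f z - f x ∣ ≤ ε * (z - x)
      chain {x} {y} {z} xy yz = begin
        ∣ f z - f x ∣                    ≤⟨ ∣∣-cong-≤ (solve 3 (λ u v w → w :- u
            := (w :- v) :+ (v :- u)) refl (f x) (f y) (f z)) ⟩
        ∣ (f z - f y) + (f y - f x) ∣    ≤⟨ ∣x+y∣≤∣x∣+∣y∣ _ _ ⟩
        ∣ f z - f y ∣ + ∣ f y - f x ∣    ≤⟨ +-mono-≤ yz xy ⟩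
        ε * (z - y) + ε * (y - x)        ≈⟨ solve 4 (λ ε x y z → ε :* (z :- y) :+ ε :* (y :- x)
            := ε :* (z :- x)) refl ε x y z ⟩
        ε * (z - x)                      ∎

      Good : Pred Carrier 0ℓ
      Good x = ∣ f x - f 0# ∣ ≤ ε * x

      from-0 : ∀ {x} → Good x → ∣ f x - f 0# ∣ ≤ ε * (x - 0#)
      from-0 {x} x-good = ≤-trans x-good (≤-reflexive (solve 2 (λ ε x → ε :* x := ε :* (x :- :0)) refl ε x))

      to-good : ∀ {x} → ∣ f x - f 0# ∣ ≤ ε * (x - 0#) → Good x
      to-good {x} x-good = ≤-trans x-good (≤-reflexive (solve 2 (λ ε x → ε :* (x :- :0) := ε :* x) refl ε x))

      S : Pred Carrier 0ℓ
      S x = 0# ≤ x × x ≤ b × Good x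

      0∈S : S 0#
      0∈S = ≤-refl , 0≤b , (begin
        ∣ f 0# - f 0# ∣  ≤⟨ ∣∣-cong-≤ (-‿inverseʳ (f 0#)) ⟩
        ∣ 0# ∣           ≈⟨ 0≤x⇒∣x∣≈x ≤-refl ⟩
        0#               ≈⟨ zeroʳ ε ⟨
        ε * 0#           ∎)

      module _ {s : Carrier} (s-sup : LeastUpperBound S s) where

        ub : UpperBound S s
        ub = proj₁ s-sup

        s-good : Good s
        -- Approaching the supremum only yields contradictions, so the bound is decided first and
        -- its failure refuted.
        s-good with ∣ f s - f 0# ∣ ≤? ε * s
        ... | yes good = good
        ... | no  bad with δ , 0<δ , near ← flat s =
          ⊥-elim (supremum-approached s-sup 0<δ λ { x x∈S@(_ , _ , x-good) ∣x-s∣<δ →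
            bad (to-good (chain (from-0 x-good) (begin
              ∣ f s - f x ∣      ≤⟨ ∣∣-cong-≤ (solve 2 (λ u v → u :- v := :- (v :- u)) refl (f s) (f x)) ⟩
              ∣ - (f x - f s) ∣  ≤⟨ ∣-x∣≤∣x∣ _ ⟩
              ∣ f x - f s ∣      ≤⟨ near x ∣x-s∣<δ ⟩
              ε * ∣ x - s ∣      ≤⟨ *-monoˡ-≤ (<⇒≤ 0<ε) (≤-trans (∣∣-cong-≤ (solve 2 (λ x s → x :- s
                  := :- (s :- x)) refl x s)) (∣-x∣≤∣x∣ _)) ⟩
              ε * ∣ s - x ∣      ≈⟨ *-congˡ (0≤x⇒∣x∣≈x (x≤y⇒0≤y-x (ub x x∈S))) ⟩
              ε * (s - x)        ∎))) })

        s≈b : s ≈ b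
        s≈b with proj₂ s-sup b (λ x x∈S → proj₁ (proj₂ x∈S))
        ... | inj₂ s≈b = s≈b
        ... | inj₁ s<b
          with δ , 0<δ , near ← flat s
          with y , s<y , y≤b , ∣y-s∣<δ ← step-right s<b 0<δ
          = ⊥-elim (<⇒≱ s<y (ub y (≤-trans (ub 0# 0∈S) (<⇒≤ s<y) , y≤b ,
              to-good (chain (from-0 s-good) (≤-trans (near y ∣y-s∣<δ)
                (≤-reflexive (*-congˡ (0≤x⇒∣x∣≈x (x≤y⇒0≤y-x (<⇒≤ s<y))))))))))

        b-good : Good b
        b-good = begin
          ∣ f b - f 0# ∣  ≤⟨ ∣∣-cong-≤ (+-congʳ (f-cong (sym s≈b))) ⟩
          ∣ f s - f 0# ∣  ≤⟨ s-good ⟩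
          ε * s           ≈⟨ *-congˡ s≈b ⟩
          ε * b           ∎

  HasDerivative-resp : ∀ f {x m n} → m ≈ n → HasDerivative f x m → HasDerivative f x n
  HasDerivative-resp f m≈n f′ ε 0<ε with δ , 0<δ , near ← f′ ε 0<ε =
    δ , 0<δ , λ h h<δ → ≤-trans (∣∣-cong-≤ (+-congˡ (-‿cong (*-congʳ (sym m≈n))))) (near h h<δ)

  HasDerivative-neg : ∀ f {x m} → HasDerivative f x m → HasDerivative (λ y → - f y) x (- m)
  HasDerivative-neg f {x} {m} f′ ε 0<ε with δ , 0<δ , near ← f′ ε 0<ε =
    δ , 0<δ , λ h h<δ → begin
      ∣ (- f (x + h) - - f x) - - m * h ∣  ≤⟨ ∣∣-cong-≤ (solve 4 (λ u v m h → (:- u :- :- v) :- :- m :* h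
          := :- ((u :- v) :- m :* h)) refl _ (f x) m h) ⟩
      ∣ - ((f (x + h) - f x) - m * h) ∣    ≤⟨ ∣-x∣≤∣x∣ _ ⟩
      ∣ (f (x + h) - f x) - m * h ∣        ≤⟨ near h h<δ ⟩
      ε * ∣ h ∣                            ∎

  HasDerivative-shift : ∀ f {m} → Congruent _≈_ _≈_ f → ∀ x y → HasDerivative f (x + y) m → HasDerivative (λ z →
      f (z + y)) x m
  HasDerivative-shift f f-cong x y f′ ε 0<ε with δ , 0<δ , near ← f′ ε 0<ε =
    δ , 0<δ , λ h h<δ → ≤-trans (∣∣-cong-≤ (+-congʳ (+-congʳ
      (f-cong (solve 3 (λ x y h → (x :+ h) :+ y := (x :+ y) :+ h) refl x y h))))) (near h h<δ)

  HasDerivative-+ : ∀ f g {x m n} → HasDerivative f x m → HasDerivative g x n → HasDerivative (λ y →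
      f y + g y) x (m + n)
  HasDerivative-+ f g {x} {m} {n} f′ g′ ε 0<ε
    with δ₁ , 0<δ₁ , near₁ ← f′ (ε * ½) (half-pos 0<ε)
    with δ₂ , 0<δ₂ , near₂ ← g′ (ε * ½) (half-pos 0<ε)
    with δ , 0<δ , δ≤δ₁ , δ≤δ₂ ← positive-min 0<δ₁ 0<δ₂
    = δ , 0<δ , λ h h<δ → begin
      ∣ ((f (x + h) + g (x + h)) - (f x + g x)) - (m + n) * h ∣
        ≤⟨ ∣∣-cong-≤ (solve 7 (λ u u′ v v′ m n h → ((u :+ v) :- (u′ :+ v′)) :- (m :+ n) :* h
            := ((u :- u′) :- m :* h) :+ ((v :- v′) :- n :* h)) refl _ (f x) _ (g x) m n h) ⟩
      ∣ ((f (x + h) - f x) - m * h) + ((g (x + h) - g x) - n * h) ∣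
        ≤⟨ ∣x+y∣≤∣x∣+∣y∣ _ _ ⟩
      ∣ (f (x + h) - f x) - m * h ∣ + ∣ (g (x + h) - g x) - n * h ∣
        ≤⟨ +-mono-≤ (near₁ h (<-≤-trans h<δ δ≤δ₁)) (near₂ h (<-≤-trans h<δ δ≤δ₂)) ⟩
      ε * ½ * ∣ h ∣ + ε * ½ * ∣ h ∣
        ≈⟨ distribʳ _ _ _ ⟨
      (ε * ½ + ε * ½) * ∣ h ∣
        ≈⟨ *-congʳ (x*½+x*½≈x ε) ⟩
      ε * ∣ h ∣ ∎

  HasDerivative-* : ∀ f g {x m n} → HasDerivative f x m → HasDerivative g x n →
                    HasDerivative (λ y → f y * g y) x (m * g x + f x * n)
  HasDerivative-* f g {x} {m} {n} f′ g′ η 0<η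
    -- With errors ρ and σ of the two factors, the total error is ρ g + f σ + (m h + ρ)(n h + σ). As
    -- |ρ| and |σ| are at most ε |h| ≤ |h|, the last product is at most (|m| + 1)(|n| + 1) h².
    -- Taking |h| ≤ ε as well bounds the whole by ε |h| times the sum chosen here.
    with ε , 0<ε , ε≤1 , εM≤η ← arbitrarily-small {∣ g x ∣ + ∣ f x ∣ + (∣ m ∣ + 1#) * (∣ n ∣ + 1#)}
           (<-respʳ-≈ (+-comm _ _) (<-respˡ-≈ (+-identityʳ 0#) (+-mono-<-≤ (*-pos (0<1+nonneg (∣∣-nonneg m)) (0<1+nonneg (∣∣-nonneg n)))
                        (+-nonneg (∣∣-nonneg (g x)) (∣∣-nonneg (f x)))))) 0<η
    with δ₁ , 0<δ₁ , near₁ ← f′ ε 0<ε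
    with δ₂ , 0<δ₂ , near₂ ← g′ ε 0<ε
    with δ₃ , 0<δ₃ , δ₃≤δ₁ , δ₃≤δ₂ ← positive-min 0<δ₁ 0<δ₂
    with δ , 0<δ , δ≤δ₃ , δ≤ε ← positive-min 0<δ₃ 0<ε
    = δ , 0<δ , λ h h<δ →
      let ρ  = (f (x + h) - f x) - m * h
          σ  = (g (x + h) - g x) - n * h
          H  = ∣ h ∣
          0≤H = ∣∣-nonneg h
          ρ≤ = near₁ h (<-≤-trans h<δ (≤-trans δ≤δ₃ δ₃≤δ₁))
          σ≤ = near₂ h (<-≤-trans h<δ (≤-trans δ≤δ₃ δ₃≤δ₂))
      in begin
      ∣ (f (x + h) * g (x + h) - f x * g x) - (m * g x + f x * n) * h ∣
        ≤⟨ ∣∣-cong-≤ (solve 7 (λ u u′ v v′ m n h →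
             (u :* v :- u′ :* v′) :- (m :* v′ :+ u′ :* n) :* h
             := (((u :- u′) :- m :* h) :* v′ :+ u′ :* ((v :- v′) :- n :* h))
                :+ (m :* h :+ ((u :- u′) :- m :* h)) :* (n :* h :+ ((v :- v′) :- n :* h))) refl _ (f x) _ (g x) m n h) ⟩
      ∣ (ρ * g x + f x * σ) + (m * h + ρ) * (n * h + σ) ∣
        ≤⟨ ≤-trans (∣x+y∣≤∣x∣+∣y∣ _ _) (+-mono-≤ (∣x+y∣≤∣x∣+∣y∣ _ _) ≤-refl) ⟩
      (∣ ρ * g x ∣ + ∣ f x * σ ∣) + ∣ (m * h + ρ) * (n * h + σ) ∣
        ≤⟨ +-mono-≤
             (+-mono-≤ (≤-trans (∣x*y∣≤∣x∣*∣y∣ _ _) (*-monoʳ-≤ (∣∣-nonneg (g x)) ρ≤))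
                       (≤-trans (∣x*y∣≤∣x∣*∣y∣ _ _) (*-monoˡ-≤ (∣∣-nonneg (f x)) σ≤)))
             (≤-trans (∣x*y∣≤∣x∣*∣y∣ _ _)
               (*-mono-≤ (∣∣-nonneg _) (*-nonneg (<⇒≤ (0<1+nonneg (∣∣-nonneg n))) 0≤H)
                 (increment-bound m h ρ≤ ε≤1) (increment-bound n h σ≤ ε≤1))) ⟩
      (ε * H * ∣ g x ∣ + ∣ f x ∣ * (ε * H)) + (∣ m ∣ + 1#) * H * ((∣ n ∣ + 1#) * H)
        ≤⟨ +-mono-≤ ≤-refl (*-monoˡ-≤ (*-nonneg (<⇒≤ (0<1+nonneg (∣∣-nonneg m))) 0≤H)
             (*-monoˡ-≤ (<⇒≤ (0<1+nonneg (∣∣-nonneg n))) (≤-trans (<⇒≤ h<δ) δ≤ε))) ⟩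
      (ε * H * ∣ g x ∣ + ∣ f x ∣ * (ε * H)) + (∣ m ∣ + 1#) * H * ((∣ n ∣ + 1#) * ε)
        ≈⟨ solve 6 (λ ε H g f m n → (ε :* H :* g :+ f :* (ε :* H)) :+ m :* H :* (n :* ε)
            := ε :* (g :+ f :+ m :* n) :* H) refl ε H _ _ _ _ ⟩
      ε * (∣ g x ∣ + ∣ f x ∣ + (∣ m ∣ + 1#) * (∣ n ∣ + 1#)) * H
        ≤⟨ *-monoʳ-≤ 0≤H εM≤η ⟩
      η * H ∎
    where
    increment-bound : ∀ m h {ρ ε} → ∣ ρ ∣ ≤ ε * ∣ h ∣ → ε ≤ 1# → ∣ m * h + ρ ∣ ≤ (∣ m ∣ + 1#) * ∣ h ∣
    increment-bound m h {ρ} {ε} ρ≤ ε≤1 = begin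
      ∣ m * h + ρ ∣                ≤⟨ ∣x+y∣≤∣x∣+∣y∣ _ _ ⟩
      ∣ m * h ∣ + ∣ ρ ∣            ≤⟨ +-mono-≤ (∣x*y∣≤∣x∣*∣y∣ m h) (≤-trans ρ≤ (*-monoʳ-≤ (∣∣-nonneg h) ε≤1)) ⟩
      ∣ m ∣ * ∣ h ∣ + 1# * ∣ h ∣   ≈⟨ distribʳ _ _ _ ⟨
      (∣ m ∣ + 1#) * ∣ h ∣         ∎

  abstract
    neg-continuous : ∀ (f : Carrier → Carrier) {f′ : Carrier → Carrier} → Congruent _≈_ _≈_ f →
                     (∀ x → HasDerivative f x (f′ x)) → ∀ x → Continuous (λ y → - f y) x
    neg-continuous f f-cong f′ x =
      differentiable⇒continuous (λ y → - f y) (λ x≈y → -‿cong (f-cong x≈y)) (HasDerivative-neg f (f′ x))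

-- Sine, cosine and π from the differential equations.

module TrigonometryProperties (R : CompleteOrderedField) (T : Trigonometry R) where

  open CompleteOrderedField R hiding (zero)
  open Trigonometry T
  open OrderedField R
  open Calculus R
  open import Relation.Binary.Reasoning.StrictPartialOrder strictPartialOrder

  -- No initial values are recorded, so that quarter turns and translates of (`sin`, `cos`) qualify
  -- too.
  record IsRotation (s c : Carrier → Carrier) : Set where
    field
      s-cong : Congruent _≈_ _≈_ s
      c-cong : Congruent _≈_ _≈_ c
      s′     : ∀ x → HasDerivative s x (c x)
      c′     : ∀ x → HasDerivative c x (- s x)

  -- Applied to (sin , cos) and its translates, this yields the addition formulas.
  rotation-conserved : ∀ {s c s̃ c̃} → IsRotation s c → IsRotation s̃ c̃ → ∀ {x} → 0# ≤ x →
                       s x * s̃ x + c x * c̃ x ≈ s 0# * s̃ 0# + c 0# * c̃ 0#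
  rotation-conserved {s} {c} {s̃} {c̃} F G = zero-derivative⇒constant (λ x → s x * s̃ x + c x * c̃ x)
    (λ x≈y → +-cong (*-cong (F.s-cong x≈y) (G.s-cong x≈y)) (*-cong (F.c-cong x≈y) (G.c-cong x≈y)))
    (λ x → HasDerivative-resp (λ x → s x * s̃ x + c x * c̃ x)
      (solve 4 (λ s c s̃ c̃ → (c :* s̃ :+ s :* c̃) :+ (:- s :* c̃ :+ c :* :- s̃)
          := :0) refl (s x) (c x) (s̃ x) (c̃ x))
      (HasDerivative-+ (λ x → s x * s̃ x) (λ x → c x * c̃ x) (HasDerivative-* s s̃ (F.s′ x) (G.s′ x)) (HasDerivative-* c c̃ (F.c′ x) (G.c′ x))))
    where
    module F = IsRotation F
    module G = IsRotation G

  sin-cos-rotation : IsRotation sin cos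
  sin-cos-rotation = record { s-cong = sin-cong ; c-cong = cos-cong ; s′ = sin′ ; c′ = cos′ }

  cos-sin-rotation : IsRotation cos (λ x → - sin x)
  cos-sin-rotation = record
    { s-cong = cos-cong
    ; c-cong = λ x≈y → -‿cong (sin-cong x≈y)
    ; s′     = cos′
    ; c′     = λ x → HasDerivative-neg sin (sin′ x)
    }

  shifted-rotation : ∀ y → IsRotation (λ x → sin (x + y)) (λ x → cos (x + y))
  shifted-rotation y = record
    { s-cong = λ x≈x′ → sin-cong (+-congʳ x≈x′)
    ; c-cong = λ x≈x′ → cos-cong (+-congʳ x≈x′)
    ; s′     = λ x → HasDerivative-shift sin sin-cong x y (sin′ (x + y))
    ; c′     = λ x → HasDerivative-shift cos cos-cong x y (cos′ (x + y))
    }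

  -- Two rotations, one ahead of the other by y, keep their scalar product: its value at time 0 is
  -- `cos y`, at time x it is the right-hand side. The sign condition is that of
  -- `zero-derivative⇒constant`.
  cos-rotate-back : ∀ {x} y → 0# ≤ x → cos y ≈ sin (x + y) * sin x + cos (x + y) * cos x
  cos-rotate-back {x} y 0≤x = begin-equality
    cos y                                              ≈⟨ cos-cong (+-identityˡ y) ⟨
    cos (0# + y)                                       ≈⟨ solve 2 (λ s c → c
        := s :* :0 :+ c :* :1) refl (sin (0# + y)) (cos (0# + y)) ⟩
    sin (0# + y) * 0# + cos (0# + y) * 1#              ≈⟨ +-cong (*-congˡ sin-0) (*-congˡ cos-0) ⟨
    sin (0# + y) * sin 0# + cos (0# + y) * cos 0#
        ≈⟨ rotation-conserved (shifted-rotation y) sin-cos-rotation 0≤x ⟨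
    sin (x + y) * sin x + cos (x + y) * cos x          ∎

  sin-rotate-back : ∀ {x} y → 0# ≤ x → sin y ≈ sin (x + y) * cos x + cos (x + y) * - sin x
  sin-rotate-back {x} y 0≤x = begin-equality
    sin y                                              ≈⟨ sin-cong (+-identityˡ y) ⟨
    sin (0# + y)                                       ≈⟨ solve 2 (λ s c → s
        := s :* :1 :+ c :* :- :0) refl (sin (0# + y)) (cos (0# + y)) ⟩
    sin (0# + y) * 1# + cos (0# + y) * - 0#            ≈⟨ +-cong (*-congˡ cos-0) (*-congˡ (-‿cong sin-0)) ⟨
    sin (0# + y) * cos 0# + cos (0# + y) * - sin 0#
        ≈⟨ rotation-conserved (shifted-rotation y) cos-sin-rotation 0≤x ⟨
    sin (x + y) * cos x + cos (x + y) * - sin x        ∎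

  sin²+cos²≈1 : ∀ {x} → 0# ≤ x → sin x * sin x + cos x * cos x ≈ 1#
  sin²+cos²≈1 {x} 0≤x = begin-equality
    sin x * sin x + cos x * cos x
        ≈⟨ +-cong (*-congʳ (sin-cong (+-identityʳ x))) (*-congʳ (cos-cong (+-identityʳ x))) ⟨
    sin (x + 0#) * sin x + cos (x + 0#) * cos x  ≈⟨ cos-rotate-back 0# 0≤x ⟨
    cos 0#                                       ≈⟨ cos-0 ⟩
    1#                                           ∎

  cos-minus : ∀ {x} u → 0# ≤ x → cos (u - x) ≈ cos u * cos x + sin u * sin x
  cos-minus {x} u 0≤x = begin-equality
    cos (u - x)                                               ≈⟨ cos-rotate-back (u - x) 0≤x ⟩
    sin (x + (u - x)) * sin x + cos (x + (u - x)) * cos x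
        ≈⟨ +-cong (*-congʳ (increment sin sin-cong x u)) (*-congʳ (increment cos cos-cong x u)) ⟩
    sin u * sin x + cos u * cos x                             ≈⟨ +-comm _ _ ⟩
    cos u * cos x + sin u * sin x                             ∎

  -- The two formulas for rotating back are a linear system for `S` and `C`, with an orthogonal
  -- matrix; solving it for `C` gives the addition formula.
  cos-plus : ∀ {x} y → 0# ≤ x → cos (x + y) ≈ cos x * cos y - sin x * sin y
  cos-plus {x} y 0≤x = begin-equality
    C                                                      ≈⟨ *-identityʳ C ⟨
    C * 1#                                                 ≈⟨ *-congˡ (sin²+cos²≈1 0≤x) ⟨
    C * (sin x * sin x + cos x * cos x)                    ≈⟨ solve 4 (λ S C s c → C :* (s :* s :+ c :* c)
        := c :* (S :* s :+ C :* c) :- s :* (S :* c :+ C :* :- s)) refl S C (sin x) (cos x) ⟩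
    cos x * (S * sin x + C * cos x) - sin x * (S * cos x + C * - sin x)
      ≈⟨ +-cong (*-congˡ (cos-rotate-back y 0≤x)) (-‿cong (*-congˡ (sin-rotate-back y 0≤x))) ⟨
    cos x * cos y - sin x * sin y                          ∎
    where
    S C : Carrier
    S = sin (x + y)
    C = cos (x + y)

  abstract
    -- The derivative at 0 is `cos 0#`, that is 1, so tolerance ½ leaves sin h ≥ h - h/2.
    sin-positive-near-0 : ∀ {x} → 0# < x → ∃[ h ] 0# < h × h ≤ x × 0# < sin h
    sin-positive-near-0 {x} 0<x
      with δ , 0<δ , near ← sin′ 0# ½ 0<½
      with h , 0<h , h≤δ½ , h≤x ← positive-min (half-pos 0<δ) 0<x
      = h , 0<h , h≤x , <-by (begin-strict
        - ((sin (0# + h) - sin 0#) - cos 0# * h)  ≤⟨ -x≤∣x∣ _ ⟩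
        ∣ (sin (0# + h) - sin 0#) - cos 0# * h ∣
            ≤⟨ near h (≤-<-trans (≤-reflexive (0≤x⇒∣x∣≈x (<⇒≤ 0<h))) (≤-<-trans h≤δ½ (half-< 0<δ))) ⟩
        ½ * ∣ h ∣                                 ≈⟨ *-comm _ _ ⟩
        ∣ h ∣ * ½                                 ≈⟨ *-congʳ (0≤x⇒∣x∣≈x (<⇒≤ 0<h)) ⟩
        h * ½                                     <⟨ half-< 0<h ⟩
        h                                         ∎) (begin-equality
        0# + h                                                  ≈⟨ solve 2 (λ h s → :0 :+ h
            := s :+ :- ((s :- :0) :- :1 :* h)) refl h (sin h) ⟩
        sin h + - ((sin h - 0#) - 1# * h)
            ≈⟨ +-congˡ (-‿cong (+-cong (+-cong (sin-cong (+-identityˡ h)) (-‿cong sin-0)) (-‿cong (*-congʳ cos-0)))) ⟨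
        sin h + - ((sin (0# + h) - sin 0#) - cos 0# * h)        ∎)

  abstract
    decreasing-intermediate-value : ∀ (f : Carrier → Carrier) {f′ : Carrier → Carrier} → Congruent _≈_ _≈_ f →
        (∀ x → HasDerivative f x (f′ x)) →
                                    ∀ {a b c} → a ≤ b → c ≤ f a → f b ≤ c → ∃[ s ] a ≤ s × s ≤ b × f s ≈ c
    decreasing-intermediate-value f f-cong f′ {c = c} a≤b c≤fa fb≤c
      with s , a≤s , s≤b , eq ← intermediate-value (λ y → - f y) (λ x≈y → -‿cong (f-cong x≈y)) (neg-continuous f f-cong f′)
                                  a≤b (neg-mono-≤ c≤fa) (neg-mono-≤ fb≤c)
      = s , a≤s , s≤b , (begin-equality
        f s      ≈⟨ solve 1 (λ x → x := :- :- x) refl (f s) ⟩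
        - - f s  ≈⟨ -‿cong eq ⟩
        - - c    ≈⟨ solve 1 (λ x → :- :- x := x) refl c ⟩
        c        ∎)

  -- Sine is positive just to the right of 0, so a nonpositive value before π would force a zero in
  -- between, against `π-least`.
  sin-positive : ∀ {x} → 0# < x → x < π → 0# < sin x
  sin-positive {x} 0<x x<π with ≤-<-connex (sin x) 0#
  ... | inj₂ 0<sinx = 0<sinx
  ... | inj₁ sinx≤0
    with h , 0<h , h≤x , 0<sinh ← sin-positive-near-0 0<x
    with s , h≤s , s≤x , sins≈0 ← decreasing-intermediate-value sin sin-cong sin′ h≤x (<⇒≤ 0<sinh) sinx≤0
    = ⊥-elim (π-least s (<-≤-trans 0<h h≤s) (≤-<-trans s≤x x<π) sins≈0)

  sin-nonneg : ∀ {x} → 0# ≤ x → x ≤ π → 0# ≤ sin x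
  sin-nonneg (inj₁ 0<x) (inj₁ x<π) = <⇒≤ (sin-positive 0<x x<π)
  sin-nonneg (inj₂ 0≈x) _ = ≤-reflexive (trans (sym sin-0) (sin-cong 0≈x))
  sin-nonneg _ (inj₂ x≈π) = ≤-reflexive (trans (sym sin-π) (sin-cong (sym x≈π)))

  -- cos x - cos y = 2 sin h sin m for the half difference h and the midpoint m.
  cos-strictly-decreasing : ∀ {x y} → 0# ≤ x → x < y → y ≤ π → cos y < cos x
  cos-strictly-decreasing {x} {y} 0≤x x<y y≤π = <-by (+-pos 0<p 0<p) (begin-equality
    cos y + (p + p)
      ≈⟨ +-congʳ (cos-cong (trans (sym (x*½+x*½≈x y)) (solve 3 (λ x y k → y :* k :+ y :* k
          := (y :- x) :* k :+ (x :+ y) :* k) refl x y ½))) ⟩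
    cos (h + m) + (p + p)
      ≈⟨ +-congʳ (cos-plus m 0≤h) ⟩
    (cos h * cos m - p) + (p + p)
      ≈⟨ solve 4 (λ sh ch sm cm → (ch :* cm :- sh :* sm) :+ (sh :* sm :+ sh :* sm)
          := (cm :* ch :+ sm :* sh) :+ :0) refl (sin h) (cos h) (sin m) (cos m) ⟩
    (cos m * cos h + sin m * sin h) + 0#
      ≈⟨ +-congʳ (cos-minus m 0≤h) ⟨
    cos (m - h) + 0#
      ≈⟨ +-congʳ (cos-cong (trans (solve 3 (λ x y k → (x :+ y) :* k :- (y :- x) :* k
          := x :* k :+ x :* k) refl x y ½) (x*½+x*½≈x x))) ⟩
    cos x + 0# ∎)
    where
    h m p : Carrier
    h = (y - x) * ½
    m = (x + y) * ½
    p = sin h * sin m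
    0<h : 0# < h
    0<h = half-pos (x<y⇒0<y-x x<y)
    0≤h : 0# ≤ h
    0≤h = <⇒≤ 0<h
    h≤m : h ≤ m
    h≤m = *-monoʳ-≤ (<⇒≤ 0<½) (≤-by (+-nonneg 0≤x 0≤x) (solve 2 (λ x y → (y :- x) :+ (x :+ x)
        := (x :+ y) :+ :0) refl x y))
    m<π : m < π
    m<π = begin-strict
      (x + y) * ½    <⟨ *-monoʳ-< 0<½ (+-mono-< y x<y) ⟩
      (y + y) * ½    ≈⟨ trans (distribʳ _ _ _) (x*½+x*½≈x y) ⟩
      y              ≤⟨ y≤π ⟩
      π              ∎
    0<p : 0# < p
    0<p = *-pos (sin-positive 0<h (≤-<-trans h≤m m<π)) (sin-positive (<-≤-trans 0<h h≤m) m<π)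

  cos-decreasing : ∀ {x y} → 0# ≤ x → x ≤ y → y ≤ π → cos y ≤ cos x
  cos-decreasing 0≤x (inj₁ x<y) y≤π = <⇒≤ (cos-strictly-decreasing 0≤x x<y y≤π)
  cos-decreasing 0≤x (inj₂ x≈y) y≤π = ≤-reflexive (cos-cong (sym x≈y))

  cos-reflects-≤ : ∀ {x y} → 0# ≤ x → y ≤ π → cos x ≤ cos y → y ≤ x
  cos-reflects-≤ 0≤x y≤π cosx≤cosy = ≮⇒≥ λ x<y → <⇒≱ (cos-strictly-decreasing 0≤x x<y y≤π) cosx≤cosy

  -- From sin π = 0 the cosine is 1 or -1, and 1 is excluded because cosine decreases strictly from
  -- 1 on [0, π].
  cos-π : cos π ≈ - 1#
  cos-π = [ (λ eq → ⊥-elim (<-irrefl eq (<-by (<-respʳ-≈ cos-0 (cos-strictly-decreasing ≤-refl 0<π ≤-refl))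
              (solve 1 (λ c → (c :- :1) :+ :1 := :0 :+ c) refl (cos π)))))
          , (λ eq → trans (solve 1 (λ c → c := (c :+ :1) :- :1) refl (cos π)) (trans (+-congʳ eq) (+-identityˡ _))) ]′
          (*-zero-split (begin-equality
    (cos π - 1#) * (cos π + 1#)                        ≈⟨ solve 1 (λ c → (c :- :1) :* (c :+ :1)
        := (:0 :* :0 :+ c :* c) :- :1) refl (cos π) ⟩
    (0# * 0# + cos π * cos π) - 1#                     ≈⟨ +-congʳ (+-congʳ (*-cong sin-π sin-π)) ⟨
    (sin π * sin π + cos π * cos π) - 1#               ≈⟨ +-congʳ (sin²+cos²≈1 (<⇒≤ 0<π)) ⟩
    1# - 1#                                            ≈⟨ -‿inverseʳ 1# ⟩
    0#                                                 ∎))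

  abstract
    arccos : ∀ {t} → - 1# ≤ t → t ≤ 1# → ∃[ θ ] 0# ≤ θ × θ ≤ π × cos θ ≈ t
    arccos -1≤t t≤1 = decreasing-intermediate-value cos cos-cong cos′ (<⇒≤ 0<π)
      (≤-trans t≤1 (≤-reflexive (sym cos-0))) (≤-trans (≤-reflexive cos-π) -1≤t)

  -- The root is twice the sine of 60°: if 2 cos θ = 1, then (2 sin θ)² = 4 - 1.
  √3 : ∃[ g ] g * g ≈ 1# + 1# + 1#
  √3 with θ , 0≤θ , _ , cosθ≈½ ← arccos {½} (≤-trans (0≤x⇒-x≤0 0≤1) (<⇒≤ 0<½))
                                            (<⇒≤ (<-≤-trans (<-respˡ-≈ (*-identityˡ ½) (half-< 0<1)) ≤-refl))
    = (1# + 1#) * sin θ , (begin-equality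
      (1# + 1#) * sin θ * ((1# + 1#) * sin θ)
        ≈⟨ solve 2 (λ s c → :2 :* s :* (:2 :* s)
            := :4 :* (s :* s :+ c :* c) :- :2 :* c :* (:2 :* c)) refl (sin θ) (cos θ) ⟩
      (1# + 1# + 1# + 1#) * (sin θ * sin θ + cos θ * cos θ) - (1# + 1#) * cos θ * ((1# + 1#) * cos θ)
        ≈⟨ +-cong (*-congˡ (sin²+cos²≈1 0≤θ)) (-‿cong (*-cong 2cosθ≈1 2cosθ≈1)) ⟩
      (1# + 1# + 1# + 1#) * 1# - 1# * 1#
        ≈⟨ solve 0 (:4 :* :1 :- :1 :* :1 := :3) refl ⟩
      1# + 1# + 1# ∎)
      where
      2cosθ≈1 : (1# + 1#) * cos θ ≈ 1#
      2cosθ≈1 = trans (*-congˡ cosθ≈½) 2*½≈1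

-- Orthonormal frames, the law of cosines and intersecting disks.

module SphereGeometry (R : CompleteOrderedField) (T : Trigonometry R) where

  open CompleteOrderedField R hiding (zero)
  open Trigonometry T
  open Spherical R T
  open OrderedField R
  open TrigonometryProperties R T
  open import Relation.Binary.Reasoning.StrictPartialOrder strictPartialOrder

  ℝ³ : Set
  ℝ³ = Vector Carrier 3

  i₀ i₁ i₂ : Fin 3
  i₀ = zero
  i₁ = suc zero
  i₂ = suc (suc zero)

  combination : Carrier → ℝ³ → Carrier → ℝ³ → ℝ³
  combination α a β b i = α * a i + β * b i

  abstract
    ⟨⟩-comm : ∀ a b → ⟨ a , b ⟩ ≈ ⟨ b , a ⟩
    ⟨⟩-comm a b = +-cong (*-comm _ _) (+-cong (*-comm _ _) (+-cong (*-comm _ _) refl))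

    ⟨⟩-linearˡ : ∀ α a β b c → ⟨ combination α a β b , c ⟩ ≈ α * ⟨ a , c ⟩ + β * ⟨ b , c ⟩
    ⟨⟩-linearˡ α a β b c = solve 11 (λ α a₀ a₁ a₂ β b₀ b₁ b₂ c₀ c₁ c₂ →
      (α :* a₀ :+ β :* b₀) :* c₀ :+ ((α :* a₁ :+ β :* b₁) :* c₁ :+ ((α :* a₂ :+ β :* b₂) :* c₂ :+ :0))
      := α :* (a₀ :* c₀ :+ (a₁ :* c₁ :+ (a₂ :* c₂ :+ :0))) :+ β :* (b₀ :* c₀ :+ (b₁ :* c₁ :+ (b₂ :* c₂ :+ :0))))
      refl α (a i₀) (a i₁) (a i₂) β (b i₀) (b i₁) (b i₂) (c i₀) (c i₁) (c i₂)

    ⟨⟩-linearʳ : ∀ α a β b c → ⟨ c , combination α a β b ⟩ ≈ α * ⟨ c , a ⟩ + β * ⟨ c , b ⟩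
    ⟨⟩-linearʳ α a β b c = trans (⟨⟩-comm c (combination α a β b)) (trans (⟨⟩-linearˡ α a β b c)
      (+-cong (*-congˡ (⟨⟩-comm a c)) (*-congˡ (⟨⟩-comm b c))))

    ⟨⟩-combinations : ∀ α a β b γ c δ d → ⟨ combination α a β b , combination γ c δ d ⟩
                      ≈ α * (γ * ⟨ a , c ⟩ + δ * ⟨ a , d ⟩) + β * (γ * ⟨ b , c ⟩ + δ * ⟨ b , d ⟩)
    ⟨⟩-combinations α a β b γ c δ d = trans (⟨⟩-linearˡ α a β b (combination γ c δ d))
      (+-cong (*-congˡ (⟨⟩-linearʳ γ c δ d a)) (*-congˡ (⟨⟩-linearʳ γ c δ d b)))

    ⟨⟩-combination : ∀ α a β b → ⟨ combination α a β b , combination α a β b ⟩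
                     ≈ α * α * ⟨ a , a ⟩ + (1# + 1#) * (α * β) * ⟨ a , b ⟩ + β * β * ⟨ b , b ⟩
    ⟨⟩-combination α a β b = begin-equality
      ⟨ combination α a β b , combination α a β b ⟩
        ≈⟨ ⟨⟩-combinations α a β b α a β b ⟩
      α * (α * ⟨ a , a ⟩ + β * ⟨ a , b ⟩) + β * (α * ⟨ b , a ⟩ + β * ⟨ b , b ⟩)
        ≈⟨ +-congˡ (*-congˡ (+-congʳ (*-congˡ (⟨⟩-comm b a)))) ⟩
      α * (α * ⟨ a , a ⟩ + β * ⟨ a , b ⟩) + β * (α * ⟨ a , b ⟩ + β * ⟨ b , b ⟩)
        ≈⟨ solve 5 (λ α β x y z → α :* (α :* x :+ β :* y) :+ β :* (α :* y :+ β :* z)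
            := α :* α :* x :+ :2 :* (α :* β) :* y :+ β :* β :* z) refl α β _ _ _ ⟩
      α * α * ⟨ a , a ⟩ + (1# + 1#) * (α * β) * ⟨ a , b ⟩ + β * β * ⟨ b , b ⟩ ∎

  ê₀ ê₁ : ℝ³
  ê₀ = 1# ∷ 0# ∷ 0# ∷ []
  ê₁ = 0# ∷ 1# ∷ 0# ∷ []

  -- A self-adjoint isometry taking the first basis vector to v, so that
  -- H a lists the coordinates of a in an orthonormal frame starting with v.
  record Frame (v : ℝ³) : Set where
    field
      H            : ℝ³ → ℝ³
      isometric    : ∀ a b → ⟨ H a , H b ⟩ ≈ ⟨ a , b ⟩
      self-adjoint : ∀ a b → ⟨ H a , b ⟩ ≈ ⟨ a , H b ⟩
      pole         : ∀ a → ⟨ v , a ⟩ ≈ ⟨ H ê₀ , a ⟩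

    abstract
      first-coordinate : ∀ a → H a i₀ ≈ ⟨ v , a ⟩
      first-coordinate a = begin-equality
        H a i₀           ≈⟨ solve 3 (λ x y z → x
            := x :* :1 :+ (y :* :0 :+ (z :* :0 :+ :0))) refl (H a i₀) (H a i₁) (H a i₂) ⟩
        ⟨ H a , ê₀ ⟩     ≈⟨ self-adjoint a ê₀ ⟩
        ⟨ a , H ê₀ ⟩     ≈⟨ ⟨⟩-comm a (H ê₀) ⟩
        ⟨ H ê₀ , a ⟩     ≈⟨ pole a ⟨
        ⟨ v , a ⟩        ∎

      parseval : ∀ a b → ⟨ a , b ⟩ ≈ ⟨ v , a ⟩ * ⟨ v , b ⟩ + (H a i₁ * H b i₁ + H a i₂ * H b i₂)
      parseval a b = begin-equality
        ⟨ a , b ⟩                                                      ≈⟨ isometric a b ⟨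
        H a i₀ * H b i₀ + (H a i₁ * H b i₁ + (H a i₂ * H b i₂ + 0#))
            ≈⟨ +-cong (*-cong (first-coordinate a) (first-coordinate b)) (+-congˡ (+-identityʳ _)) ⟩
        ⟨ v , a ⟩ * ⟨ v , b ⟩ + (H a i₁ * H b i₁ + H a i₂ * H b i₂)    ∎

      tangent-unit : ⟨ H ê₁ , H ê₁ ⟩ ≈ 1#
      tangent-unit = trans (isometric ê₁ ê₁) (solve 0 (:0 :* :0 :+ (:1 :* :1 :+ (:0 :* :0 :+ :0)) := :1) refl)

      tangent-orthogonal : ⟨ v , H ê₁ ⟩ ≈ 0#
      tangent-orthogonal = trans (pole (H ê₁)) (trans (isometric ê₀ ê₁)
        (solve 0 (:1 :* :0 :+ (:0 :* :1 :+ (:0 :* :0 :+ :0)) := :0) refl))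

      second-coordinate : ∀ a → ⟨ H ê₁ , a ⟩ ≈ H a i₁
      second-coordinate a = trans (self-adjoint ê₁ a)
        (solve 3 (λ x y z → :0 :* x :+ (:1 :* y :+ (:0 :* z :+ :0)) := y) refl (H a i₀) (H a i₁) (H a i₂))

  -- A reflection only when k ⟨ n , n ⟩ = 2.
  reflect : Carrier → ℝ³ → ℝ³ → ℝ³
  reflect k n a = combination 1# a (- (k * ⟨ n , a ⟩)) n

  abstract
    reflect-isometric : ∀ k n → k * ⟨ n , n ⟩ ≈ 1# + 1# → ∀ a b → ⟨ reflect k n a , reflect k n b ⟩ ≈ ⟨ a , b ⟩
    reflect-isometric k n k⟨n,n⟩≈2 a b = begin-equality
      ⟨ reflect k n a , reflect k n b ⟩
        ≈⟨ ⟨⟩-combinations 1# a (- (k * t)) n 1# b (- (k * s)) n ⟩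
      1# * (1# * ⟨ a , b ⟩ + - (k * s) * ⟨ a , n ⟩) + - (k * t) * (1# * s + - (k * s) * ⟨ n , n ⟩)
        ≈⟨ +-congʳ (*-congˡ (+-congˡ (*-congˡ (⟨⟩-comm a n)))) ⟩
      1# * (1# * ⟨ a , b ⟩ + - (k * s) * t) + - (k * t) * (1# * s + - (k * s) * ⟨ n , n ⟩)
        ≈⟨ solve 5 (λ p k s t q →
            :1 :* (:1 :* p :+ :- (k :* s) :* t) :+ :- (k :* t) :* (:1 :* s :+ :- (k :* s) :* q)
                := p :+ k :* s :* t :* (k :* q :- :2)) refl ⟨ a , b ⟩ k s t ⟨ n , n ⟩ ⟩
      ⟨ a , b ⟩ + k * s * t * (k * ⟨ n , n ⟩ - (1# + 1#))
        ≈⟨ +-congˡ (*-congˡ (trans (+-congʳ k⟨n,n⟩≈2) (-‿inverseʳ _))) ⟩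
      ⟨ a , b ⟩ + k * s * t * 0#
        ≈⟨ trans (+-congˡ (zeroʳ _)) (+-identityʳ _) ⟩
      ⟨ a , b ⟩ ∎
      where
      t s : Carrier
      t = ⟨ n , a ⟩
      s = ⟨ n , b ⟩

    reflect-self-adjoint : ∀ k n a b → ⟨ reflect k n a , b ⟩ ≈ ⟨ a , reflect k n b ⟩
    reflect-self-adjoint k n a b = begin-equality
      ⟨ reflect k n a , b ⟩                               ≈⟨ ⟨⟩-linearˡ 1# a (- (k * ⟨ n , a ⟩)) n b ⟩
      1# * ⟨ a , b ⟩ + - (k * ⟨ n , a ⟩) * ⟨ n , b ⟩      ≈⟨ solve 4 (λ p k t s → :1 :* p :+ :- (k :* t) :* s
          := :1 :* p :+ :- (k :* s) :* t) refl ⟨ a , b ⟩ k ⟨ n , a ⟩ ⟨ n , b ⟩ ⟩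
      1# * ⟨ a , b ⟩ + - (k * ⟨ n , b ⟩) * ⟨ n , a ⟩      ≈⟨ +-congˡ (*-congˡ (⟨⟩-comm n a)) ⟩
      1# * ⟨ a , b ⟩ + - (k * ⟨ n , b ⟩) * ⟨ a , n ⟩      ≈⟨ ⟨⟩-linearʳ 1# b (- (k * ⟨ n , b ⟩)) n a ⟨
      ⟨ a , reflect k n b ⟩                               ∎

    x+y≈0⇒x≈0 : ∀ {x y} → 0# ≤ x → 0# ≤ y → x + y ≈ 0# → x ≈ 0#
    x+y≈0⇒x≈0 {x} {y} 0≤x 0≤y eq = ≤-antisym
      (≤-by 0≤y (trans eq (sym (+-identityʳ 0#)))) 0≤x

    -- This is the Householder reflection exchanging v and `ê₀`. Its normal is n = v - `ê₀`, and ⟨n,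
    -- n⟩ = 2 (1 - v₀), so k is the inverse of 1 - v₀. Only a field inverse is involved, no square
    -- root.
    householder-frame : ∀ v → ⟨ v , v ⟩ ≈ 1# → ¬ (1# - v i₀ ≈ 0#) → Frame v
    householder-frame v v-unit 1-x≉0 with k , [1-x]k≈1 ← inverse (1# - v i₀) 1-x≉0 = record
      { H            = reflect k n
      ; isometric    = reflect-isometric k n (begin-equality
          k * ⟨ n , n ⟩
            ≈⟨ solve 4 (λ k x y z → k :* ((x :- :1) :* (x :- :1) :+ (y :* y :+ (z :* z :+ :0)))
                 := k :* ((x :* x :+ (y :* y :+ (z :* z :+ :0))) :- :1) :+ :2 :* ((:1 :- x) :* k)) refl k (v i₀)
                     (v i₁) (v i₂) ⟩
          k * (⟨ v , v ⟩ - 1#) + (1# + 1#) * ((1# - v i₀) * k)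
            ≈⟨ +-cong (*-congˡ (+-congʳ v-unit)) (*-congˡ [1-x]k≈1) ⟩
          k * (1# - 1#) + (1# + 1#) * 1#
            ≈⟨ solve 1 (λ k → k :* (:1 :- :1) :+ :2 :* :1 := :2) refl k ⟩
          1# + 1# ∎)
      ; self-adjoint = reflect-self-adjoint k n
      ; pole         = λ a → begin-equality
          ⟨ v , a ⟩
            ≈⟨ solve 6 (λ x y z a b c → x :* a :+ (y :* b :+ (z :* c :+ :0))
                 := :1 :* (:1 :* a :+ (:0 :* b :+ (:0 :* c :+ :0))) :+ :1 :* ((x :- :1) :* a :+ (y :* b :+
                     (z :* c :+ :0))))
                 refl (v i₀) (v i₁) (v i₂) (a i₀) (a i₁) (a i₂) ⟩
          1# * ⟨ ê₀ , a ⟩ + 1# * ⟨ n , a ⟩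
            ≈⟨ +-congˡ (*-congʳ (trans (sym [1-x]k≈1) (solve 4 (λ k x y z →
                 (:1 :- x) :* k
                     := :- (k :* ((x :- :1) :* :1 :+ (y :* :0 :+ (z :* :0 :+ :0))))) refl k (v i₀) (v i₁) (v i₂)))) ⟩
          1# * ⟨ ê₀ , a ⟩ + - (k * ⟨ n , ê₀ ⟩) * ⟨ n , a ⟩
            ≈⟨ ⟨⟩-linearˡ 1# ê₀ (- (k * ⟨ n , ê₀ ⟩)) n a ⟨
          ⟨ reflect k n ê₀ , a ⟩ ∎
      }
      where
      n : ℝ³
      n = (v i₀ - 1#) ∷ v i₁ ∷ v i₂ ∷ []

    -- The reflection degenerates when v₀ = 1. For a unit vector the other coordinates then vanish,
    -- v is `ê₀` itself, and the identity serves as the frame.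
    frame : ∀ v → ⟨ v , v ⟩ ≈ 1# → Frame v
    frame v v-unit with compare (1# - v i₀) 0#
    ... | tri≈ _ 1-x≈0 _ = record
      { H            = λ a → a
      ; isometric    = λ _ _ → refl
      ; self-adjoint = λ _ _ → refl
      ; pole         = λ a → +-cong (*-congʳ x≈1) (+-cong (*-congʳ y≈0) (+-congʳ (*-congʳ z≈0)))
      }
      where
      x≈1 : v i₀ ≈ 1#
      x≈1 = begin-equality
        v i₀                ≈⟨ solve 1 (λ x → x := :1 :- (:1 :- x)) refl (v i₀) ⟩
        1# - (1# - v i₀)    ≈⟨ +-congˡ (-‿cong 1-x≈0) ⟩
        1# - 0#             ≈⟨ solve 0 (:1 :- :0 := :1) refl ⟩
        1#                  ∎
      yy+zz≈0 : v i₁ * v i₁ + v i₂ * v i₂ ≈ 0#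
      yy+zz≈0 = begin-equality
        v i₁ * v i₁ + v i₂ * v i₂   ≈⟨ solve 3 (λ x y z → y :* y :+ z :* z
            := (x :* x :+ (y :* y :+ (z :* z :+ :0))) :- x :* x) refl (v i₀) (v i₁) (v i₂) ⟩
        ⟨ v , v ⟩ - v i₀ * v i₀     ≈⟨ +-cong v-unit (-‿cong (*-cong x≈1 x≈1)) ⟩
        1# - 1# * 1#                ≈⟨ solve 0 (:1 :- :1 :* :1 := :0) refl ⟩
        0#                          ∎
      y≈0 : v i₁ ≈ 0#
      y≈0 = square≈0⇒≈0 (x+y≈0⇒x≈0 (square-nonneg _) (square-nonneg _) yy+zz≈0)
      z≈0 : v i₂ ≈ 0#
      z≈0 = square≈0⇒≈0 (x+y≈0⇒x≈0 (square-nonneg _) (square-nonneg _) (trans (+-comm _ _) yy+zz≈0))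
    ... | tri< _ 1-x≉0 _ = householder-frame v v-unit 1-x≉0
    ... | tri> _ 1-x≉0 _ = householder-frame v v-unit 1-x≉0

  cos-dist : 𝕊² → 𝕊² → Carrier
  cos-dist a b = ⟨ vec a , vec b ⟩

  frame-at : ∀ a → Frame (vec a)
  frame-at a = frame (vec a) (unit a)

  module _ (o a : 𝕊²) where
    open Frame (frame-at o)

    -- These are the coordinates of the part of a orthogonal to o. It points along the arc from o to
    -- a, and its length is the sine of their distance.
    tangent₁ tangent₂ : Carrier
    tangent₁ = H (vec a) i₁
    tangent₂ = H (vec a) i₂

  tangent-product : 𝕊² → 𝕊² → 𝕊² → Carrier
  tangent-product o a b = tangent₁ o a * tangent₁ o b + tangent₂ o a * tangent₂ o b

  abstract
    -- This is the spherical law of cosines: `tangent-product` is the product of the sines of the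
    -- two sides at o and the cosine of the angle between them.
    cos-law : ∀ o a b → cos-dist a b ≈ cos-dist o a * cos-dist o b + tangent-product o a b
    cos-law o a b = Frame.parseval (frame-at o) (vec a) (vec b)

    tangent-norm : ∀ o a → tangent-product o a a ≈ 1# - cos-dist o a * cos-dist o a
    tangent-norm o a = begin-equality
      tangent-product o a a            ≈⟨ solve 2 (λ s c → s := (c :+ s) :- c) refl _ (cos-dist o a * cos-dist o a) ⟩
      (cos-dist o a * cos-dist o a + tangent-product o a a) - cos-dist o a * cos-dist o a
                                       ≈⟨ +-congʳ (trans (sym (cos-law o a a)) (unit a)) ⟩
      1# - cos-dist o a * cos-dist o a ∎

    tangent-norm-nonneg : ∀ o a → 0# ≤ tangent-product o a a
    tangent-norm-nonneg o a = +-nonneg (square-nonneg _) (square-nonneg _)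

    cos-dist²≤1 : ∀ a b → cos-dist a b * cos-dist a b ≤ 1#
    cos-dist²≤1 a b = 0≤y-x⇒x≤y (≤-trans (tangent-norm-nonneg a b) (≤-reflexive (tangent-norm a b)))

    cos-dist≤1 : ∀ a b → cos-dist a b ≤ 1#
    cos-dist≤1 a b = square-cancel-≤ 0≤1 (≤-trans (cos-dist²≤1 a b) (≤-reflexive (sym (*-identityʳ 1#))))

    -1≤cos-dist : ∀ a b → - 1# ≤ cos-dist a b
    -1≤cos-dist a b = ≤-by (square-cancel-≤ { - cos-dist a b} 0≤1 (≤-trans
      (≤-reflexive (solve 1 (λ x → :- x :* :- x := x :* x) refl (cos-dist a b)))
      (≤-trans (cos-dist²≤1 a b) (≤-reflexive (sym (*-identityʳ 1#))))))
      (solve 1 (λ x → :- :1 :+ :1 := x :+ :- x) refl (cos-dist a b))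

    cos-dist-comm : ∀ a b → cos-dist a b ≈ cos-dist b a
    cos-dist-comm a b = ⟨⟩-comm (vec a) (vec b)

  -- The distance of the centers is at most the sum of the radii, expressed
  -- through the cosine, which is decreasing on [0, π] only.
  Near : Disk → Disk → Set
  Near D E = π ≤ radius D + radius E ⊎ cos (radius D + radius E) ≤ cos-dist (center D) (center E)

  near? : Binary.Decidable Near
  near? D E = (π ≤? radius D + radius E) ⊎-dec (cos (radius D + radius E) ≤? cos-dist (center D) (center E))

  near-sym : ∀ {D E} → Near D E → Near E D
  near-sym {D} {E} (inj₁ π≤) = inj₁ (≤-trans π≤ (≤-reflexive (+-comm _ _)))
  near-sym {D} {E} (inj₂ cos≤) = inj₂ (≤-trans (≤-reflexive (cos-cong (+-comm _ _)))
    (≤-trans cos≤ (≤-reflexive (cos-dist-comm (center D) (center E)))))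

  radius-sum-nonneg : ∀ D E → 0# ≤ radius D + radius E
  radius-sum-nonneg D E = +-nonneg (<⇒≤ (0<radius D)) (<⇒≤ (0<radius E))

  sin² : ∀ {θ c} → 0# ≤ θ → cos θ ≈ c → sin θ * sin θ ≈ 1# - c * c
  sin² {θ} {c} 0≤θ cosθ≈c = begin-equality
    sin θ * sin θ                                          ≈⟨ solve 2 (λ s c → s
        := (s :+ c) :- c) refl _ (cos θ * cos θ) ⟩
    (sin θ * sin θ + cos θ * cos θ) - cos θ * cos θ
        ≈⟨ +-cong (sin²+cos²≈1 0≤θ) (-‿cong (*-cong cosθ≈c cosθ≈c)) ⟩
    1# - c * c                                             ∎

  cauchy-schwarz₂ : ∀ p q p′ q′ → (p * p′ + q * q′) * (p * p′ + q * q′) ≤ (p * p + q * q) * (p′ * p′ + q′ * q′)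
  cauchy-schwarz₂ p q p′ q′ = ≤-by (square-nonneg (p * q′ - q * p′))
    (solve 4 (λ p q p′ q′ → (p :* p′ :+ q :* q′) :* (p :* p′ :+ q :* q′) :+ (p :* q′ :- q :* p′) :* (p :* q′ :- q :* p′)
      := (p :* p :+ q :* q) :* (p′ :* p′ :+ q′ :* q′) :+ :0) refl p q p′ q′)

  -- By Cauchy-Schwarz in the tangent plane at o, -m is at most sin α sin β, with equality for a
  -- straight angle. In this form the triangle inequality also makes sense for α + β > π.
  cos-triangle : ∀ o a b {α β} → Distance o a α → Distance o b β → cos (α + β) ≤ cos-dist a b
  cos-triangle o a b {α} {β} (0≤α , α≤π , cosα≈) (0≤β , β≤π , cosβ≈) = begin
    cos (α + β)                              ≈⟨ cos-plus β 0≤α ⟩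
    cos α * cos β - sin α * sin β            ≤⟨ ≤-by -m≤ss (solve 3 (λ c s m → (c :- s) :+ s
        := (c :+ m) :+ :- m) refl _ _ m) ⟩
    cos α * cos β + m                        ≈⟨ +-congʳ (*-cong cosα≈ cosβ≈) ⟩
    cos-dist o a * cos-dist o b + m          ≈⟨ cos-law o a b ⟨
    cos-dist a b                             ∎
    where
    m : Carrier
    m = tangent-product o a b
    -m≤ss : - m ≤ sin α * sin β
    -m≤ss = square-cancel-≤ (*-nonneg (sin-nonneg 0≤α α≤π) (sin-nonneg 0≤β β≤π)) (begin
      - m * - m                                          ≈⟨ solve 1 (λ m → :- m :* :- m := m :* m) refl m ⟩
      m * m
          ≤⟨ cauchy-schwarz₂ (tangent₁ o a) (tangent₂ o a) (tangent₁ o b) (tangent₂ o b) ⟩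
      tangent-product o a a * tangent-product o b b
          ≈⟨ *-cong (trans (tangent-norm o a) (sym (sin² 0≤α cosα≈))) (trans (tangent-norm o b) (sym
              (sin² 0≤β cosβ≈))) ⟩
      sin α * sin α * (sin β * sin β)                    ≈⟨ solve 2 (λ s t → s :* s :* (t :* t)
          := s :* t :* (s :* t)) refl (sin α) (sin β) ⟩
      sin α * sin β * (sin α * sin β)                    ∎)

  intersect⇒near : ∀ {D E} → Intersect D E → Near D E
  intersect⇒near {D} {E} (u , (α , uD , α≤r) , (β , uE , β≤s)) with ≤-total π (radius D + radius E)
  ... | inj₁ π≤r+s = inj₁ π≤r+s
  ... | inj₂ r+s≤π = inj₂ (≤-trans
    (cos-decreasing (+-nonneg (proj₁ uD) (proj₁ uE)) (+-mono-≤ α≤r β≤s) r+s≤π) (cos-triangle u (center D) (center E) uD uE))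

  -- When θ is the distance of a and b, these conditions say that w is a unit tangent at a with b =
  -- cos θ a + sin θ w.
  IsDirection : 𝕊² → 𝕊² → Carrier → ℝ³ → Set
  IsDirection a b θ w = ⟨ w , w ⟩ ≈ 1# × ⟨ vec a , w ⟩ ≈ 0# × ⟨ w , vec b ⟩ ≈ sin θ

  abstract
    regular-direction : ∀ a b {θ k} → Distance a b θ → sin θ * k ≈ 1# →
                        IsDirection a b θ (combination k (vec b) (- (k * cos-dist a b)) (vec a))
    regular-direction a b {θ} {k} (0≤θ , _ , cosθ≈) sk≈1 = w-unit , orthogonal , (begin-equality
        ⟨ w , vec b ⟩                                     ≈⟨ ⟨⟩-linearˡ k (vec b) (- (k * c)) (vec a) (vec b) ⟩
        k * ⟨ vec b , vec b ⟩ + - (k * c) * c             ≈⟨ +-congʳ (*-congˡ (unit b)) ⟩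
        k * 1# + - (k * c) * c                            ≈⟨ solve 2 (λ k c → k :* :1 :+ :- (k :* c) :* c
            := k :* (:1 :- c :* c)) refl k c ⟩
        k * (1# - c * c)                                  ≈⟨ *-congˡ (sin² 0≤θ cosθ≈) ⟨
        k * (s * s)                                       ≈⟨ solve 2 (λ k s → k :* (s :* s) := s :* k :* s) refl k s ⟩
        s * k * s                                         ≈⟨ trans (*-congʳ sk≈1) (*-identityˡ s) ⟩
        s                                                 ∎)
      where
      c s : Carrier
      c = cos-dist a b
      s = sin θ
      w : ℝ³
      w = combination k (vec b) (- (k * c)) (vec a)
      orthogonal : ⟨ vec a , w ⟩ ≈ 0#
      orthogonal = begin-equality
        ⟨ vec a , w ⟩                                     ≈⟨ ⟨⟩-linearʳ k (vec b) (- (k * c)) (vec a) (vec a) ⟩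
        k * c + - (k * c) * ⟨ vec a , vec a ⟩             ≈⟨ +-congˡ (*-congˡ (unit a)) ⟩
        k * c + - (k * c) * 1#                            ≈⟨ solve 2 (λ k c → k :* c :+ :- (k :* c) :* :1
            := :0) refl k c ⟩
        0#                                                ∎
      w-unit : ⟨ w , w ⟩ ≈ 1#
      w-unit = begin-equality
        ⟨ w , w ⟩
          ≈⟨ ⟨⟩-combination k (vec b) (- (k * c)) (vec a) ⟩
        k * k * ⟨ vec b , vec b ⟩ + (1# + 1#) * (k * - (k * c)) * ⟨ vec b , vec a ⟩ + - (k * c) * -
            (k * c) * ⟨ vec a , vec a ⟩
          ≈⟨ +-cong (+-cong (*-congˡ (unit b)) (*-congˡ (cos-dist-comm b a))) (*-congˡ (unit a)) ⟩
        k * k * 1# + (1# + 1#) * (k * - (k * c)) * c + - (k * c) * - (k * c) * 1#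
          ≈⟨ solve 2 (λ k c → k :* k :* :1 :+ :2 :* (k :* :- (k :* c)) :* c :+ :- (k :* c) :* :- (k :* c) :* :1
              := k :* k :* (:1 :- c :* c)) refl k c ⟩
        k * k * (1# - c * c)
          ≈⟨ *-congˡ (sin² 0≤θ cosθ≈) ⟨
        k * k * (s * s)
          ≈⟨ solve 2 (λ k s → k :* k :* (s :* s) := s :* k :* (s :* k)) refl k s ⟩
        s * k * (s * k)
          ≈⟨ trans (*-cong sk≈1 sk≈1) (*-identityʳ 1#) ⟩
        1# ∎

    -- Here b is a or its antipode, and every tangent direction leads to b: both tangent coordinates
    -- of b vanish, as their squares add up to sin² θ.
    degenerate-direction : ∀ a b {θ} → Distance a b θ → sin θ ≈ 0# → ∀ {w} →
                           ⟨ w , w ⟩ ≈ 1# → ⟨ vec a , w ⟩ ≈ 0# → ⟨ w , vec b ⟩ ≈ tangent₁ a b → IsDirection a b θ w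
    degenerate-direction a b {θ} (0≤θ , _ , cosθ≈) sinθ≈0 {w} w-unit orthogonal w-b = w-unit , orthogonal , (begin-equality
      ⟨ w , vec b ⟩    ≈⟨ w-b ⟩
      tangent₁ a b
          ≈⟨ square≈0⇒≈0 (x+y≈0⇒x≈0 (square-nonneg (tangent₁ a b)) (square-nonneg (tangent₂ a b)) norm≈0) ⟩
      0#               ≈⟨ sinθ≈0 ⟨
      sin θ            ∎)
      where
      norm≈0 : tangent-product a b b ≈ 0#
      norm≈0 = begin-equality
        tangent-product a b b               ≈⟨ tangent-norm a b ⟩
        1# - cos-dist a b * cos-dist a b    ≈⟨ sin² 0≤θ cosθ≈ ⟨
        sin θ * sin θ                       ≈⟨ *-congˡ sinθ≈0 ⟩
        sin θ * 0#                          ≈⟨ zeroʳ _ ⟩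
        0#                                  ∎

    direction : ∀ a b {θ} → Distance a b θ → ∃[ w ] IsDirection a b θ w
    direction a b {θ} ab with compare 0# (sin θ)
    ... | tri> _ _ sinθ<0 = ⊥-elim (<⇒≱ sinθ<0 (sin-nonneg (proj₁ ab) (proj₁ (proj₂ ab))))
    ... | tri≈ _ 0≈sinθ _ = H ê₁ , degenerate-direction a b ab (sym 0≈sinθ) {H ê₁} tangent-unit tangent-orthogonal (second-coordinate (vec b))
      where open Frame (frame-at a)
    ... | tri< 0<sinθ _ _ with k , sk≈1 ← inverse (sin θ) (>0⇒≉0 0<sinθ) =
      combination k (vec b) (- (k * cos-dist a b)) (vec a) , regular-direction a b ab sk≈1

  -- The point is cos ρ a + sin ρ w for a direction w from a to b; its distance to b comes from the
  -- subtraction formula of cosine.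
  point-towards : ∀ a b {θ ρ} → Distance a b θ → 0# ≤ ρ → ρ ≤ θ → ∃[ u ] Distance u a ρ × Distance u b (θ - ρ)
  point-towards a b {θ} {ρ} ab@(0≤θ , θ≤π , cosθ≈) 0≤ρ ρ≤θ with w , w-unit , orthogonal , w-b ← direction a b ab =
    u , (0≤ρ , ≤-trans ρ≤θ θ≤π , sym u-a)
      , (x≤y⇒0≤y-x ρ≤θ , ≤-trans (≤-by 0≤ρ (solve 2 (λ θ ρ → (θ :- ρ) :+ ρ := θ :+ :0) refl θ ρ)) θ≤π , sym u-b)
    where
    c s : Carrier
    c = cos ρ
    s = sin ρ
    u : 𝕊²
    u = record
      { vec  = combination c (vec a) s w
      ; unit = begin-equality
          ⟨ combination c (vec a) s w , combination c (vec a) s w ⟩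
            ≈⟨ ⟨⟩-combination c (vec a) s w ⟩
          c * c * ⟨ vec a , vec a ⟩ + (1# + 1#) * (c * s) * ⟨ vec a , w ⟩ + s * s * ⟨ w , w ⟩
            ≈⟨ +-cong (+-cong (*-congˡ (unit a)) (*-congˡ orthogonal)) (*-congˡ w-unit) ⟩
          c * c * 1# + (1# + 1#) * (c * s) * 0# + s * s * 1#
            ≈⟨ solve 2 (λ c s → c :* c :* :1 :+ :2 :* (c :* s) :* :0 :+ s :* s :* :1 := s :* s :+ c :* c) refl c s ⟩
          s * s + c * c
            ≈⟨ sin²+cos²≈1 0≤ρ ⟩
          1# ∎
      }
    u-a : cos-dist u a ≈ c
    u-a = begin-equality
      cos-dist u a                                      ≈⟨ ⟨⟩-linearˡ c (vec a) s w (vec a) ⟩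
      c * ⟨ vec a , vec a ⟩ + s * ⟨ w , vec a ⟩
          ≈⟨ +-cong (*-congˡ (unit a)) (*-congˡ (trans (⟨⟩-comm w (vec a)) orthogonal)) ⟩
      c * 1# + s * 0#                                   ≈⟨ solve 2 (λ c s → c :* :1 :+ s :* :0 := c) refl c s ⟩
      c                                                 ∎
    u-b : cos-dist u b ≈ cos (θ - ρ)
    u-b = begin-equality
      cos-dist u b                                      ≈⟨ ⟨⟩-linearˡ c (vec a) s w (vec b) ⟩
      c * cos-dist a b + s * ⟨ w , vec b ⟩              ≈⟨ +-cong (*-congˡ (sym cosθ≈)) (*-congˡ w-b) ⟩
      c * cos θ + s * sin θ                             ≈⟨ +-cong (*-comm _ _) (*-comm _ _) ⟩
      cos θ * c + sin θ * s                             ≈⟨ cos-minus θ 0≤ρ ⟨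
      cos (θ - ρ)                                       ∎

  near⇒distance≤ : ∀ {D E θ} → Near D E → Distance (center D) (center E) θ → θ ≤ radius D + radius E
  near⇒distance≤ (inj₁ π≤r+s) (_ , θ≤π , _) = ≤-trans θ≤π π≤r+s
  near⇒distance≤ {D} {E} (inj₂ cos≤) (_ , θ≤π , cosθ≈) =
    cos-reflects-≤ (radius-sum-nonneg D E) θ≤π (≤-trans cos≤ (≤-reflexive (sym cosθ≈)))

  -- A common point lies at distance `radius D` from the center of `D` on the way to the center of
  -- `E`. If that would overshoot, the center of `E` itself lies in `D`.
  near⇒intersect : ∀ {D E} → Near D E → Intersect D E
  near⇒intersect {D} {E} near =
    let θ , DE@(0≤θ , θ≤π , cosθ≈) = arccos {cos-dist (center D) (center E)} (-1≤cos-dist (center D) (center E)) (cos-dist≤1 (center D) (center E))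
        center-E : θ ≤ radius D → Intersect D E
        center-E θ≤r = center E
          , (θ , (0≤θ , θ≤π , trans cosθ≈ (cos-dist-comm (center D) (center E))) , θ≤r)
          , (0# , (≤-refl , <⇒≤ 0<π , trans cos-0 (sym (unit (center E)))) , <⇒≤ (0<radius E))
        between : radius D < θ → Intersect D E
        between r<θ =
          let u , u-D , u-E = point-towards (center D) (center E) DE (<⇒≤ (0<radius D)) (<⇒≤ r<θ)
          in u , (radius D , u-D , ≤-refl)
               , (θ - radius D , u-E , ≤-by (near⇒distance≤ {D} {E} near DE)
                   (solve 3 (λ θ r s → (θ :- r) :+ (r :+ s) := s :+ θ) refl θ (radius D) (radius E)))
    in [ center-E , between ]′ (≤-<-connex θ (radius D))

-- The six sectors and the triangle with an angle of at most 60°.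

module Sectors (R : CompleteOrderedField) (T : Trigonometry R) where

  open CompleteOrderedField R hiding (zero)
  open Trigonometry T
  open Spherical R T
  open OrderedField R
  open TrigonometryProperties R T
  open SphereGeometry R T
  open import Relation.Binary.Reasoning.StrictPartialOrder strictPartialOrder

  -- (ξ + η ω) (ξ′ + η′ ω) as a multiple of the scalar product, for unit vectors
  -- 1 and ω at an angle of 60°.
  form : Carrier → Carrier → Carrier → Carrier → Carrier
  form ξ η ξ′ η′ = (1# + 1#) * (ξ * ξ′) + (1# + 1#) * (η * η′) + ξ * η′ + ξ′ * η

  abstract
    g : Carrier
    g = proj₁ √3

    g²≈3 : g * g ≈ 1# + 1# + 1#
    g²≈3 = proj₂ √3

    form-nonneg : ∀ {ξ η ξ′ η′} → 0# ≤ ξ → 0# ≤ η → 0# ≤ ξ′ → 0# ≤ η′ → 0# ≤ form ξ η ξ′ η′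
    form-nonneg 0≤ξ 0≤η 0≤ξ′ 0≤η′ = +-nonneg (+-nonneg (+-nonneg
      (*-nonneg (<⇒≤ 0<2) (*-nonneg 0≤ξ 0≤ξ′)) (*-nonneg (<⇒≤ 0<2) (*-nonneg 0≤η 0≤η′))) (*-nonneg 0≤ξ 0≤η′)) (*-nonneg 0≤ξ′ 0≤η)

    -- Vectors in a closed 60° sector make an angle α ≤ 60°, so 4 cos² α ≥ 1.
    form-sector : ∀ {ξ η ξ′ η′} → 0# ≤ ξ → 0# ≤ η → 0# ≤ ξ′ → 0# ≤ η′ →
                  form ξ η ξ η * form ξ′ η′ ξ′ η′ ≤ (1# + 1#) * form ξ η ξ′ η′ * ((1# + 1#) * form ξ η ξ′ η′)
    form-sector {ξ} {η} {ξ′} {η′} 0≤ξ 0≤η 0≤ξ′ 0≤η′ = ≤-by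
      -- For the scalar product s and the determinant d of two vectors u and u′, 4 s² - |u|² |u′|² =
      -- 3 s² - d² = (√3 s - d)(√3 s + d). In the coordinates ξ, η both factors become positive
      -- multiples of sums of nonnegative products; 12 is the resulting constant.
      (*-nonneg (*-nonneg (*-nonneg (<⇒≤ 0<2) (<⇒≤ 0<2)) (<⇒≤ (+-pos 0<2 0<1)))
        (*-nonneg (+-nonneg common (*-nonneg 0≤ξ 0≤η′)) (+-nonneg common (*-nonneg 0≤ξ′ 0≤η))))
      (solve 4 (λ ξ η ξ′ η′ →
        let form = λ ξ η ξ′ η′ → :2 :* (ξ :* ξ′) :+ :2 :* (η :* η′) :+ ξ :* η′ :+ ξ′ :* η in
        form ξ η ξ η :* form ξ′ η′ ξ′ η′ :+ :2 :* :2 :* :3 :* ((ξ :* ξ′ :+ η :* η′ :+ ξ :* η′) :* (ξ :* ξ′ :+ η :* η′ :+ ξ′ :* η))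
        := :2 :* form ξ η ξ′ η′ :* (:2 :* form ξ η ξ′ η′) :+ :0) refl ξ η ξ′ η′)
      where
      common : 0# ≤ ξ * ξ′ + η * η′
      common = +-nonneg (*-nonneg 0≤ξ 0≤ξ′) (*-nonneg 0≤η 0≤η′)

  -- Twice the components of (p , q) along three directions at mutual angles
  -- of 120°.  They sum to 0; those along two of the directions are both
  -- nonnegative in one 60° sector and both nonpositive in the opposite one.
  X Y Z : Carrier → Carrier → Carrier
  X p q = (1# + 1#) * p
  Y p q = g * q - p
  Z p q = - (g * q) - p

  sextant : Fin 6 → Carrier → Carrier → Carrier × Carrier
  sextant 0F p q = X p q , Y p q
  sextant 1F p q = Y p q , Z p q
  sextant 2F p q = Z p q , X p q
  sextant 3F p q = - X p q , - Y p q
  sextant 4F p q = - Y p q , - Z p q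
  sextant 5F p q = - Z p q , - X p q

  sextant-form : Fin 6 → Carrier → Carrier → Carrier → Carrier → Carrier
  sextant-form i p q p′ q′ = let ξ , η = sextant i p q ; ξ′ , η′ = sextant i p′ q′ in form ξ η ξ′ η′

  6* : Carrier → Carrier
  6* x = (1# + 1#) * ((1# + 1# + 1#) * x)

  abstract
    form-neg : ∀ ξ η ξ′ η′ → form (- ξ) (- η) (- ξ′) (- η′) ≈ form ξ η ξ′ η′
    form-neg = solve 4 (λ ξ η ξ′ η′ →
      :2 :* (:- ξ :* :- ξ′) :+ :2 :* (:- η :* :- η′) :+ :- ξ :* :- η′ :+ :- ξ′ :* :- η
      := :2 :* (ξ :* ξ′) :+ :2 :* (η :* η′) :+ ξ :* η′ :+ ξ′ :* η) refl

    -- Components along two directions at 120° are coordinates in the dual basis, which lies along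
    -- the edges of the sector, at 60°. With unit vectors e, e′ along the edges, (p, q) = (ξ e + η
    -- e′)/√3, so the scalar product is a third of half the form.
    sextant-form≈6* : ∀ i p q p′ q′ → sextant-form i p q p′ q′ ≈ 6* (p * p′ + q * q′)
    sextant-form≈6* i p q p′ q′ = begin-equality
      sextant-form i p q p′ q′                                              ≈⟨ expand i ⟩
      (1# + 1#) * ((1# + 1# + 1#) * (p * p′) + g * g * (q * q′))            ≈⟨ *-congˡ (+-congˡ (*-congʳ g²≈3)) ⟩
      (1# + 1#) * ((1# + 1# + 1#) * (p * p′) + (1# + 1# + 1#) * (q * q′))   ≈⟨ *-congˡ (distribˡ _ _ _) ⟨
      6* (p * p′ + q * q′)                                                  ∎
      where
      expand : ∀ i → sextant-form i p q p′ q′ ≈ (1# + 1#) * ((1# + 1# + 1#) * (p * p′) + g * g * (q * q′))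
      expand 0F = solve 5 (λ g p q p′ q′ → let X = λ p q → :2 :* p ; Y = λ p q → g :* q :- p ; ξ = X p q ; η = Y p q ; ξ′ = X p′ q′ ; η′ = Y p′ q′ in
        :2 :* (ξ :* ξ′) :+ :2 :* (η :* η′) :+ ξ :* η′ :+ ξ′ :* η
            := :2 :* (:3 :* (p :* p′) :+ g :* g :* (q :* q′))) refl g p q p′ q′
      expand 1F = solve 5 (λ g p q p′ q′ → let Y = λ p q → g :* q :- p ; Z = λ p q → :- (g :* q) :- p ; ξ = Y p q ; η = Z p q ; ξ′ = Y p′ q′ ; η′ = Z p′ q′ in
        :2 :* (ξ :* ξ′) :+ :2 :* (η :* η′) :+ ξ :* η′ :+ ξ′ :* η
            := :2 :* (:3 :* (p :* p′) :+ g :* g :* (q :* q′))) refl g p q p′ q′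
      expand 2F = solve 5 (λ g p q p′ q′ → let Z = λ p q → :- (g :* q) :- p ; X = λ p q → :2 :* p ; ξ = Z p q ; η = X p q ; ξ′ = Z p′ q′ ; η′ = X p′ q′ in
        :2 :* (ξ :* ξ′) :+ :2 :* (η :* η′) :+ ξ :* η′ :+ ξ′ :* η
            := :2 :* (:3 :* (p :* p′) :+ g :* g :* (q :* q′))) refl g p q p′ q′
      expand 3F = trans (form-neg _ _ _ _) (expand 0F)
      expand 4F = trans (form-neg _ _ _ _) (expand 1F)
      expand 5F = trans (form-neg _ _ _ _) (expand 2F)

  InSextant : Fin 6 → Carrier → Carrier → Set
  InSextant i p q = 0# ≤ proj₁ (sextant i p q) × 0# ≤ proj₂ (sextant i p q)

  inSextant? : ∀ i p q → Dec (InSextant i p q)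
  inSextant? i p q = (0# ≤? proj₁ (sextant i p q)) ×-dec (0# ≤? proj₂ (sextant i p q))

  abstract
    -- Pigeonhole: two of the three signs of `X`, `Y`, `Z` agree, and each pair with each common
    -- sign has its sector.
    sextants-cover : ∀ p q → ∃[ i ] InSextant i p q
    sextants-cover p q with ≤-total 0# (X p q) | ≤-total 0# (Y p q) | ≤-total 0# (Z p q)
    ... | inj₁ X≥0 | inj₁ Y≥0 | _        = 0F , X≥0 , Y≥0
    ... | _        | inj₁ Y≥0 | inj₁ Z≥0 = 1F , Y≥0 , Z≥0
    ... | inj₁ X≥0 | _        | inj₁ Z≥0 = 2F , Z≥0 , X≥0
    ... | inj₂ X≤0 | inj₂ Y≤0 | _        = 3F , x≤0⇒0≤-x X≤0 , x≤0⇒0≤-x Y≤0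
    ... | _        | inj₂ Y≤0 | inj₂ Z≤0 = 4F , x≤0⇒0≤-x Y≤0 , x≤0⇒0≤-x Z≤0
    ... | inj₂ X≤0 | _        | inj₂ Z≤0 = 5F , x≤0⇒0≤-x Z≤0 , x≤0⇒0≤-x X≤0

    sextant-product-nonneg : ∀ i {p q p′ q′} → InSextant i p q → InSextant i p′ q′ → 0# ≤ p * p′ + q * q′
    sextant-product-nonneg i {p} {q} {p′} {q′} (ξ , η) (ξ′ , η′) = *-cancelʳ-≤ (*-pos 0<2 (+-pos 0<2 0<1)) (begin
      0# * ((1# + 1#) * (1# + 1# + 1#))                    ≈⟨ zeroˡ _ ⟩
      0#                                                   ≤⟨ form-nonneg ξ η ξ′ η′ ⟩
      sextant-form i p q p′ q′                             ≈⟨ sextant-form≈6* i p q p′ q′ ⟩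
      6* (p * p′ + q * q′)                                 ≈⟨ solve 1 (λ m → :2 :* (:3 :* m)
          := m :* (:2 :* :3)) refl (p * p′ + q * q′) ⟩
      (p * p′ + q * q′) * ((1# + 1#) * (1# + 1# + 1#))     ∎)

    sextant-product-large : ∀ i {p q p′ q′} → InSextant i p q → InSextant i p′ q′ →
      (p * p + q * q) * (p′ * p′ + q′ * q′) ≤ (1# + 1#) * (p * p′ + q * q′) * ((1# + 1#) * (p * p′ + q * q′))
    sextant-product-large i {p} {q} {p′} {q′} (ξ , η) (ξ′ , η′) = *-cancelʳ-≤ (*-pos 0<6 0<6) (begin
      n * n′ * (six * six)
          ≈⟨ solve 2 (λ n n′ → n :* n′ :* (:2 :* :3 :* (:2 :* :3))
              := :2 :* (:3 :* n) :* (:2 :* (:3 :* n′))) refl n n′ ⟩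
      6* n * 6* n′
          ≈⟨ *-cong (sextant-form≈6* i p q p q) (sextant-form≈6* i p′ q′ p′ q′) ⟨
      sextant-form i p q p q * sextant-form i p′ q′ p′ q′         ≤⟨ form-sector ξ η ξ′ η′ ⟩
      (1# + 1#) * f * ((1# + 1#) * f)                             ≈⟨ *-cong (*-congˡ f≈6m) (*-congˡ f≈6m) ⟩
      (1# + 1#) * 6* m * ((1# + 1#) * 6* m)
          ≈⟨ solve 1 (λ m → :2 :* (:2 :* (:3 :* m)) :* (:2 :* (:2 :* (:3 :* m)))
              := :2 :* m :* (:2 :* m) :* (:2 :* :3 :* (:2 :* :3))) refl m ⟩
      (1# + 1#) * m * ((1# + 1#) * m) * (six * six)               ∎)
      where
      six n n′ m f : Carrier
      six = (1# + 1#) * (1# + 1# + 1#)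
      n   = p * p + q * q
      n′  = p′ * p′ + q′ * q′
      m   = p * p′ + q * q′
      f   = sextant-form i p q p′ q′
      0<6 : 0# < six
      0<6 = *-pos 0<2 (+-pos 0<2 0<1)
      f≈6m : f ≈ 6* m
      f≈6m = sextant-form≈6* i p q p′ q′

    -- In a spherical triangle with angle at most 60°, here 2 m ≥ sin α sin β,
    -- the opposite side is at most the longer one of the adjacent sides.
    opposite-side : ∀ {C C′ m} → - 1# ≤ C → C ≤ C′ → C′ ≤ 1# → 0# ≤ m →
                    (1# - C * C) * (1# - C′ * C′) ≤ (1# + 1#) * m * ((1# + 1#) * m) → C ≤ C * C′ + m
    opposite-side {C} {C′} {m} -1≤C C≤C′ C′≤1 0≤m large with ≤-total C 0#
    ... | inj₁ C≤0 = ≤-by (+-nonneg 0≤m (*-nonneg (x≤0⇒0≤-x C≤0) (x≤y⇒0≤y-x C′≤1)))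
      (solve 3 (λ C C′ m → C :+ (m :+ :- C :* (:1 :- C′)) := (C :* C′ :+ m) :+ :0) refl C C′ m)
    -- The claim is C (1 - C′) ≤ m. Since 2 C ≤ 1 + C′, twice the left side is at most 1 - C′². As 1
    -- - C′² ≤ 1 - C², the square of that is at most (1 - C²)(1 - C′²), hence at most (2 m)².
    ... | inj₂ 0≤C = ≤-by (*-cancelʳ-≤ 0<2 (begin
        C * (1# - C′) * (1# + 1#)      ≈⟨ solve 2 (λ C C′ → C :* (:1 :- C′) :* :2
            := (C :+ C) :* (:1 :- C′)) refl C C′ ⟩
        (C + C) * (1# - C′)            ≤⟨ *-monoʳ-≤ (x≤y⇒0≤y-x C′≤1) (+-mono-≤ (≤-trans C≤C′ C′≤1) C≤C′) ⟩
        (1# + C′) * (1# - C′)          ≈⟨ solve 1 (λ c → (:1 :+ c) :* (:1 :- c) := :1 :- c :* c) refl C′ ⟩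
        1# - C′ * C′
            ≤⟨ square-cancel-≤ (*-nonneg (<⇒≤ 0<2) 0≤m) (≤-trans (*-monoʳ-≤ 0≤1-C′² 1-C′²≤1-C²) large) ⟩
        (1# + 1#) * m                  ≈⟨ *-comm _ _ ⟩
        m * (1# + 1#)                  ∎))
      (solve 3 (λ C C′ m → C :+ m := (C :* C′ :+ m) :+ C :* (:1 :- C′)) refl C C′ m)
      where
      0≤C′ : 0# ≤ C′
      0≤C′ = ≤-trans 0≤C C≤C′
      1-C′²≤1-C² : 1# - C′ * C′ ≤ 1# - C * C
      1-C′²≤1-C² = +-mono-≤ ≤-refl (neg-mono-≤ (*-mono-≤ 0≤C 0≤C′ C≤C′ C≤C′))
      0≤1-C′² : 0# ≤ 1# - C′ * C′
      0≤1-C′² = x≤y⇒0≤y-x (≤-trans (*-mono-≤ 0≤C′ 0≤1 C′≤1 C′≤1) (≤-reflexive (*-identityʳ 1#)))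

  InSector : Fin 6 → 𝕊² → 𝕊² → Set
  InSector i o a = InSextant i (tangent₁ o a) (tangent₂ o a)

  abstract
    sector-opposite-side : ∀ i o a b → InSector i o a → InSector i o b →
                           cos-dist o a ≤ cos-dist o b → cos-dist o a ≤ cos-dist a b
    sector-opposite-side i o a b a∈i b∈i oa≤ob = ≤-trans
      (opposite-side (-1≤cos-dist o a) oa≤ob (cos-dist≤1 o b)
        (sextant-product-nonneg i {tangent₁ o a} {tangent₂ o a} {tangent₁ o b} {tangent₂ o b} a∈i b∈i)
        (≤-trans (≤-reflexive (sym (*-cong (tangent-norm o a) (tangent-norm o b))))
          (sextant-product-large i {tangent₁ o a} {tangent₂ o a} {tangent₁ o b} {tangent₂ o b} a∈i b∈i)))
      (≤-reflexive (sym (cos-law o a b)))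

    -- In angles: |DE| ≤ |VD| ≤ v + d ≤ d + e. The comparison of the cosines of v + d and d + e
    -- needs d + e ≤ π, so the other case is split off first.
    near-enlarge : ∀ {V D E} → radius V ≤ radius E → Near V D →
                   cos-dist (center V) (center D) ≤ cos-dist (center D) (center E) → Near D E
    near-enlarge {V} {D} {E} v≤e VD closer with ≤-total π (radius D + radius E) | VD
    ... | inj₁ π≤d+e | _          = inj₁ π≤d+e
    ... | inj₂ d+e≤π | inj₁ π≤v+d = inj₁ (≤-trans π≤v+d v+d≤d+e)
      where
      v+d≤d+e : radius V + radius D ≤ radius D + radius E
      v+d≤d+e = ≤-trans (+-mono-≤ v≤e ≤-refl) (≤-reflexive (+-comm _ _))
    ... | inj₂ d+e≤π | inj₂ cos≤  = inj₂ (≤-trans (cos-decreasing (radius-sum-nonneg V D)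
      (≤-trans (+-mono-≤ v≤e ≤-refl) (≤-reflexive (+-comm _ _))) d+e≤π) (≤-trans cos≤ closer))

    -- The smaller cosine marks the center farther from that of `V`. Its disk is kept, and the other
    -- disk takes the place of `V`.
    near-in-sector : ∀ i {V D E} → radius V ≤ radius D → radius V ≤ radius E → Near V D → Near V E →
                     InSector i (center V) (center D) → InSector i (center V) (center E) → Near D E
    near-in-sector i {V} {D} {E} v≤d v≤e VD VE D∈i E∈i
      with ≤-total (cos-dist (center V) (center D)) (cos-dist (center V) (center E))
    ... | inj₁ VD≤VE = near-enlarge {V} {D} {E} v≤e VD
      (sector-opposite-side i (center V) (center D) (center E) D∈i E∈i VD≤VE)
    ... | inj₂ VE≤VD = near-sym {E} {D} (near-enlarge {V} {E} {D} v≤d VE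
      (sector-opposite-side i (center V) (center E) (center D) E∈i D∈i VE≤VD))

-- Decidable subsets, a smallest disk and the six cliques.

module _ {n : ℕ} {P : Pred (Fin n) 0ℓ} (P? : Decidable P) where

  separate : Subset n
  separate = tabulate λ u → does (P? u)

  ∈-separate⁺ : ∀ {u} → P u → u ∈ separate
  ∈-separate⁺ {u} Pu = lookup⇒[]= u separate (≡.trans (lookup∘tabulate _ u) (dec-true (P? u) Pu))

  ∈-separate⁻ : ∀ {u} → u ∈ separate → P u
  ∈-separate⁻ {u} u∈ with P? u | ≡.trans (≡.sym (lookup∘tabulate (λ u → does (P? u)) u)) ([]=⇒lookup u∈)
  ... | yes Pu | _  = Pu
  ... | no  _  | ()

module _ (R : CompleteOrderedField) where

  open CompleteOrderedField R hiding (zero)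
  open OrderedField R

  minimizer : ∀ {n} (f : Fin (suc n) → Carrier) → ∃[ i ] ∀ j → f i ≤ f j
  minimizer {ℕ.zero} f = zero , λ { zero → ≤-refl }
  minimizer {suc n} f with i , least ← minimizer (λ j → f (suc j)) with ≤-total (f zero) (f (suc i))
  ... | inj₁ f0≤fi = zero , λ { zero → ≤-refl ; (suc j) → ≤-trans f0≤fi (least j) }
  ... | inj₂ fi≤f0 = suc i , λ { zero → fi≤f0 ; (suc j) → least j }

proposition4p2 : (R : CompleteOrderedField) (T : Trigonometry R) (G : Graph) →
    Spherical.IsSphericalDiskGraph R T G →
    ∃[ v ] Graph.IsUnionOfCliques G 6 (Graph.Neighborhood G v)
-- `NonZero` rules out order 0, so the pattern `suc n` is exhaustive and a minimum exists.
proposition4p2 R T G@(record { order = suc n }) (D , adj⇔intersect) with minimizer R (λ u → Spherical.Disk.radius (D u))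
... | v , smallest = v , (λ i → separate (neighbor-in-sector? i)) , clique , cover
  where
  open Graph G
  open Spherical R T
  open SphereGeometry R T
  open Sectors R T

  -- `Adj` comes without a decision procedure, so `Near` replaces it; as every disk is near itself,
  -- v is excluded explicitly.
  NeighborInSector : Fin 6 → Vertex → Set
  NeighborInSector i u = v ≢ u × Near (D v) (D u) × InSector i (center (D v)) (center (D u))

  neighbor-in-sector? : ∀ i → Decidable (NeighborInSector i)
  neighbor-in-sector? i u = ¬? (v ≟ u) ×-dec near? (D v) (D u) ×-dec
    inSextant? i (tangent₁ (center (D v)) (center (D u))) (tangent₂ (center (D v)) (center (D u)))

  near⇒adj : ∀ {x y} → x ≢ y → Near (D x) (D y) → Adj x y
  near⇒adj {x} {y} x≢y near = Equivalence.from (adj⇔intersect x y x≢y) (near⇒intersect {D x} {D y} near)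

  adj⇒≢ : ∀ {x y} → Adj x y → x ≢ y
  adj⇒≢ xy x≡y = irrefl x≡y xy

  adj⇒near : ∀ {x y} → Adj x y → Near (D x) (D y)
  adj⇒near {x} {y} xy = intersect⇒near {D x} {D y} (Equivalence.to (adj⇔intersect x y (adj⇒≢ xy)) xy)

  clique : ∀ i → IsClique (separate (neighbor-in-sector? i))
  clique i x y x∈ y∈ x≢y =
    let _ , near-x , x∈i = ∈-separate⁻ (neighbor-in-sector? i) x∈
        _ , near-y , y∈i = ∈-separate⁻ (neighbor-in-sector? i) y∈
    in near⇒adj x≢y (near-in-sector i {D v} {D x} {D y} (smallest x) (smallest y) near-x near-y x∈i y∈i)

  cover : ∀ u → Adj v u ⇔ (∃[ i ] u ∈ separate (neighbor-in-sector? i))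
  cover u = mk⇔
    (λ vu → let i , u∈i = sextants-cover (tangent₁ (center (D v)) (center (D u))) (tangent₂ (center (D v)) (center (D u)))
            in i , ∈-separate⁺ (neighbor-in-sector? i) (adj⇒≢ vu , adj⇒near vu , u∈i))
    (λ { (i , u∈) → let v≢u , near , _ = ∈-separate⁻ (neighbor-in-sector? i) u∈ in near⇒adj v≢u near })
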